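{- Let $n\in\{1,2\}$ and let $S$ be a constrained Petri net in the class $\mathrm{CPN}[\Sigma_n]$, over the logic $\mathrm{CML}(\mathbb{C}^N,\Omega,\Xi)$. Then, for every closed $\mathrm{CML}$ formula $\varphi$ in the fragment $\Sigma_n$, the sets of colored markings $\mathrm{post}_S([\![\varphi]\!])$ and $\mathrm{pre}_S([\![\varphi]\!])$ are effectively definable by $\mathrm{CML}$ formulas in the same fragment $\Sigma_n$.
   Context: Tokens are the natural numbers. Let $\mathbb{P}$ be a finite set of places, $\mathbb{C}$ a (possibly infinite) color domain, $N\ge 1$ an integer, $\Omega$ a set of operations on $\mathbb{C}$ and $\Xi$ a set of predicates on $\mathbb{C}$. An $N$-dim colored marking is a mapping $M:\mathbb{N}\to(\mathbb{P}\cup\{\bot\})\times\mathbb{C}^N$; if $M(t)=(p,c_1,\ldots,c_N)$, write $\mathit{place}_M(t)=p$ and $\mathit{color}_{M,k}(t)=c_k$. Syntax of $\mathrm{CML}(\mathbb{C}^N,\Omega,\Xi)$. Let $T$ be a set of token variables (ranging over $\mathbb{N}$) and $C$ a disjoint set of color variables (ranging over $\mathbb{C}$). Token color terms: $t ::= z \mid \delta_k(x)\mid o(t_1,\ldots,t_n)$ with $z\in C$, $1\le k\le N$, $x\in T$, $o\in\Omega$. Formulas: $\varphi ::= \mathit{true}\mid x=y\mid p(x)\mid r(t_1,\ldots,t_m)\mid\neg\varphi\mid\varphi\vee\varphi\mid\exists z.\,\varphi\mid\exists x.\,\varphi$ with $x,y\in T$, $z\in C$, $p\in\mathbb{P}\cup\{\bot\}$,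 $r\in\Xi$. Other connectives and $\forall$ are defined as usual; $FV(\varphi)$ is the set of free variables of $\varphi$. Semantics. For valuations $\theta:T\to\mathbb{N}$, $\nu:C\to\mathbb{C}$ and a marking $M$, the term $z$ denotes $\nu(z)$, the term $\delta_k(x)$ denotes $\mathit{color}_{M,k}(\theta(x))$, and operations are interpreted on $\mathbb{C}$. $M\models_{\theta,\nu}x=y$ iff $\theta(x)=\theta(y)$; $M\models_{\theta,\nu}p(x)$ iff $\mathit{place}_M(\theta(x))=p$; $M\models_{\theta,\nu} r(t_1,\ldots,t_m)$ iff $r$ holds of the values of $t_1,\dots,t_m$; boolean connectives are as usual; $\exists x$ ($x\in T$) quantifies over all tokens in $\mathbb{N}$ and $\exists z$ ($z\in C$) over all elements of $\mathbb{C}$. For a closed formula $\varphi$, $[\![\varphi]\!]$ is the set of colored markings $M$ with $M\models\varphi$; a set of markings is definable by $\varphi$ if it equals $[\![\varphi]\!]$; it is effectively definable if the defining formula can be computed. Fragments. A formula is in prenex normal form (PNF) if it is $Q_1y_1\ldots Q_my_m.\,\varphi$ with $Q_i\in\{\exists,\forall\}$, $y_i\in T\cup C$, $\varphi$ quantifier-free. $\Sigma_0=\Pi_0$ is the set of formulas in PNF where all quantified variables are in $C$. For $n\ge0$, $\Sigma_{n+1}$ (resp. $\Pi_{n+1}$) is the set of PNF formulas $Qy_1\ldots y_m.\,\varphi$ with $y_1,\ldots,y_m\in T\cup C$, $Q$ being $\exists$ (resp. $\forall$) and $\varphi\in\Pi_n$ (resp. $\varphi\in\Sigma_n$). A formula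 not literally in PNF is classified through its prenex normal form. A constrained Petri net (CPN) over $\mathrm{CML}(\mathbb{C}^N,\Omega,\Xi)$ is a pair $S=(\mathbb{P},\Delta)$ where $\Delta$ is a finite set of constrained transitions of the form $p_1,\ldots,p_n\hookrightarrow q_1,\ldots,q_m:\varphi$ with $p_i,q_j\in\mathbb{P}$ and $\varphi$ a $\mathrm{CML}(\mathbb{C}^N,\Omega,\Xi)$ formula (the guard) such that $FV(\varphi)=\{x_1,\ldots,x_n\}\cup\{y_1,\ldots,y_m\}$ (token variables) and all occurrences of each $y_j$ in $\varphi$ are in terms of the form $\delta_k(y_j)$. For colored markings $M,M'$, $M\to_S M'$ iff there is such a transition in $\Delta$ and there are pairwise distinct tokens $t_1,\ldots,t_n$ and pairwise distinct tokens $t'_1,\ldots,t'_m$ such that: (1) $\mathit{place}_M(t_i)=p_i$ and $\mathit{place}_{M'}(t_i)=\bot$ for all $i$; (2) $\mathit{place}_M(t'_j)=\bot$ and $\mathit{place}_{M'}(t'_j)=q_j$ for all $j$; (3) $M(t)=M'(t)$ for every token $t$ different from all $t_i$ and all $t'_j$; (4) $M\models_{\theta}\varphi[\mathit{color}_{M',k}(t'_j)/\delta_k(y_j)]_{1\le k\le N,1\le j\le m}$ where $\theta(x_i)=t_i$ for all $i$. For a set $\mathcal{M}$ of colored markings, $\mathrm{post}_S(\mathcal{M})=\{M':\exists M\in\mathcal{M},\,M\to_S M'\}$ and $\mathrm{pre}_S(\mathcal{M})=\{M':\exists M\in\mathcal{M},\,M'\to_S M\}$. For a fragment $\Theta$ of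 $\mathrm{CML}$, $\mathrm{CPN}[\Theta]$ is the class of CPNs all of whose transition guards are in $\Theta$. -}

module Defs where

open import Axiom.ExcludedMiddle using (ExcludedMiddle)
open import Data.Fin using (Fin; zero; suc; _↑ˡ_; _↑ʳ_; splitAt; combine; remQuot)
open import Data.List using (List)
import Data.List.Relation.Unary.All as List
import Data.List.Relation.Unary.Any as List
open import Data.Maybe using (Maybe; just; nothing)
open import Data.Nat using (ℕ; zero; suc; _+_; _*_)
open import Data.Product using (Σ-syntax; ∃-syntax; _×_; _,_; proj₁; proj₂)
open import Data.Sum using (_⊎_; [_,_]′)
open import Data.Unit using (⊤)
open import Data.Vec using (Vec; []; _∷_; lookup)
open import Data.Vec.Relation.Unary.Any using (Any)
import Data.Vec.Functional as F
open import Function using (id)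
open import Function.Definitions using (Injective)
open import Level using (0ℓ)
open import Relation.Binary.Construct.Closure.ReflexiveTransitive using (Star)
open import Relation.Binary.PropositionalEquality using (_≡_; _≢_)
open import Relation.Nullary using (¬_)
open import Relation.Unary using (Pred; _∈_; _≐_)

record ColorStructure : Set₁ where
  field
    ℂ    : Set
    Ω    : Set
    arΩ  : Ω → ℕ
    opΩ  : (o : Ω) → Vec ℂ (arΩ o) → ℂ
    Ξ    : Set
    arΞ  : Ξ → ℕ
    relΞ : (r : Ξ) → Vec ℂ (arΞ r) → Set

-- P is the number of places and N the dimension of the color vectors.
module CML (P N : ℕ) (𝒞 : ColorStructure) where

  open ColorStructure 𝒞

  ℙ : Set
  ℙ = Fin P

  -- ℙ ∪ {⊥}, with  nothing  for ⊥.
  Location : Set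
  Location = Maybe ℙ

  Marking : Set
  Marking = ℕ → Location × Vec ℂ N

  place : Marking → ℕ → Location
  place M s = proj₁ (M s)

  color : Marking → Fin N → ℕ → ℂ
  color M k s = lookup (proj₂ (M s)) k

  -- Variables are de Bruijn indices, separately for each of the two disjoint
  -- sorts:  Formula t c  has its free token variables in Fin t and its free
  -- color variables in Fin c.
  data Term (t c : ℕ) : Set where
    var : Fin c → Term t c
    δ   : Fin N → Fin t → Term t c
    op  : (o : Ω) → Vec (Term t c) (arΩ o) → Term t c

  infixr 5 _∨_

  data Formula (t c : ℕ) : Set where
    true : Formula t c
    _==_ : Fin t → Fin t → Formula t c
    at   : Location → Fin t → Formula t c
    rel  : (r : Ξ) → Vec (Term t c) (arΞ r) → Formula t c
    neg  : Formula t c → Formula t c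
    _∨_  : Formula t c → Formula t c → Formula t c
    ∃c   : Formula t (suc c) → Formula t c
    ∃t   : Formula (suc t) c → Formula t c

  pattern ∀c φ = neg (∃c (neg φ))
  pattern ∀t φ = neg (∃t (neg φ))

  Closed : Set
  Closed = Formula 0 0

  module _ (M : Marking) {t c : ℕ} (θ : Fin t → ℕ) (ν : Fin c → ℂ) where
    mutual
      eval : Term t c → ℂ
      eval (var z)   = ν z
      eval (δ k x)   = color M k (θ x)
      eval (op o ts) = opΩ o (evals ts)

      evals : ∀ {n} → Vec (Term t c) n → Vec ℂ n
      evals []       = []
      evals (u ∷ us) = eval u ∷ evals us

  Sat : Marking → ∀ {t c} → (Fin t → ℕ) → (Fin c → ℂ) → Formula t c → Set
  Sat M θ ν true       = ⊤
  Sat M θ ν (x == y)   = θ x ≡ θ y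
  Sat M θ ν (at p x)   = place M (θ x) ≡ p
  Sat M θ ν (rel r ts) = relΞ r (evals M θ ν ts)
  Sat M θ ν (neg φ)    = ¬ Sat M θ ν φ
  Sat M θ ν (φ ∨ ψ)    = Sat M θ ν φ ⊎ Sat M θ ν ψ
  Sat M θ ν (∃c φ)     = ∃[ d ] Sat M θ (d F.∷ ν) φ
  Sat M θ ν (∃t φ)     = ∃[ s ] Sat M (s F.∷ θ) ν φ

  ⟦_⟧ : Closed → Pred Marking 0ℓ
  ⟦ φ ⟧ M = Sat M F.[] F.[] φ

  -- A substitution renames token variables outside color terms, replaces the
  -- color variables by color terms, and replaces each δ k x, regarded as an
  -- atomic symbol, by a color term.
  record Subst (t c t′ c′ : ℕ) : Set where
    field
      token : Fin t → Fin t′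
      colv  : Fin c → Term t′ c′
      delta : Fin N → Fin t → Term t′ c′

  open Subst

  module _ {t c t′ c′ : ℕ} (σ : Subst t c t′ c′) where
    mutual
      substT : Term t c → Term t′ c′
      substT (var z)   = colv σ z
      substT (δ k x)   = delta σ k x
      substT (op o ts) = op o (substTs ts)

      substTs : ∀ {n} → Vec (Term t c) n → Vec (Term t′ c′) n
      substTs []       = []
      substTs (u ∷ us) = substT u ∷ substTs us

  wkᵗ : ∀ {t c} → Subst t c (suc t) c
  wkᵗ = record { token = suc ; colv = var ; delta = λ k x → δ k (suc x) }

  wkᶜ : ∀ {t c} → Subst t c t (suc c)
  wkᶜ = record { token = id ; colv = λ z → var (suc z) ; delta = δ }

  liftᵗ : ∀ {t c t′ c′} → Subst t c t′ c′ → Subst (suc t) c (suc t′) c′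
  liftᵗ {t} {c} {t′} {c′} σ = record
    { token = zero F.∷ λ x → suc (token σ x)
    ; colv  = λ z → substT wkᵗ (colv σ z)
    ; delta = λ k → δ k zero F.∷ λ x → substT wkᵗ (delta σ k x)
    }

  liftᶜ : ∀ {t c t′ c′} → Subst t c t′ c′ → Subst t (suc c) t′ (suc c′)
  liftᶜ σ = record
    { token = token σ
    ; colv  = var zero F.∷ λ z → substT wkᶜ (colv σ z)
    ; delta = λ k x → substT wkᶜ (delta σ k x)
    }

  substF : ∀ {t c t′ c′} → Subst t c t′ c′ → Formula t c → Formula t′ c′
  substF σ true       = true
  substF σ (x == y)   = token σ x == token σ y
  substF σ (at p x)   = at p (token σ x)
  substF σ (rel r ts) = rel r (substTs σ ts)
  substF σ (neg φ)    = neg (substF σ φ)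
  substF σ (φ ∨ ψ)    = substF σ φ ∨ substF σ ψ
  substF σ (∃c φ)     = ∃c (substF (liftᶜ σ) φ)
  substF σ (∃t φ)     = ∃t (substF (liftᵗ σ) φ)

  ↑ᵗ : ∀ {t c} → Formula t c → Formula (suc t) c
  ↑ᵗ = substF wkᵗ

  ↑ᶜ : ∀ {t c} → Formula t c → Formula t (suc c)
  ↑ᶜ = substF wkᶜ

  data QuantifierFree {t c : ℕ} : Formula t c → Set where
    true : QuantifierFree true
    _==_ : ∀ x y → QuantifierFree (x == y)
    at   : ∀ p x → QuantifierFree (at p x)
    rel  : ∀ r ts → QuantifierFree (rel r ts)
    neg  : ∀ {φ} → QuantifierFree φ → QuantifierFree (neg φ)
    _∨_  : ∀ {φ ψ} → QuantifierFree φ → QuantifierFree ψ → QuantifierFree (φ ∨ ψ)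

  data ColorPrenex {t : ℕ} : ∀ {c} → Formula t c → Set where
    matrix : ∀ {c} {φ : Formula t c} → QuantifierFree φ → ColorPrenex φ
    ∃c     : ∀ {c} {φ : Formula t (suc c)} → ColorPrenex φ → ColorPrenex (∃c φ)
    all-c  : ∀ {c} {φ : Formula t (suc c)} → ColorPrenex φ → ColorPrenex (∀c φ)

  -- The literal prenex classes; the constructors ∃c, ∃t (all-c, all-t) build up
  -- one block of quantifiers on variables of both sorts.
  mutual
    data PrenexΣ : ℕ → ∀ {t c} → Formula t c → Set where
      level₀ : ∀ {t c} {φ : Formula t c} → ColorPrenex φ → PrenexΣ 0 φ
      inner  : ∀ {n t c} {φ : Formula t c} → PrenexΠ n φ → PrenexΣ (suc n) φ
      ∃c     : ∀ {n t c} {φ : Formula t (suc c)} → PrenexΣ (suc n) φ → PrenexΣ (suc n) (∃c φ)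
      ∃t     : ∀ {n t c} {φ : Formula (suc t) c} → PrenexΣ (suc n) φ → PrenexΣ (suc n) (∃t φ)

    data PrenexΠ : ℕ → ∀ {t c} → Formula t c → Set where
      level₀ : ∀ {t c} {φ : Formula t c} → ColorPrenex φ → PrenexΠ 0 φ
      inner  : ∀ {n t c} {φ : Formula t c} → PrenexΣ n φ → PrenexΠ (suc n) φ
      all-c  : ∀ {n t c} {φ : Formula t (suc c)} → PrenexΠ (suc n) φ → PrenexΠ (suc n) (∀c φ)
      all-t  : ∀ {n t c} {φ : Formula (suc t) c} → PrenexΠ (suc n) φ → PrenexΠ (suc n) (∀t φ)

  -- One step of conversion to prenex normal form, at any position.
  infix 4 _⇝_ _⇝*_

  data _⇝_ : ∀ {t c} → Formula t c → Formula t c → Set where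
    ¬∃c : ∀ {t c} {φ : Formula t (suc c)} → neg (∃c φ) ⇝ ∀c (neg φ)
    ¬∃t : ∀ {t c} {φ : Formula (suc t) c} → neg (∃t φ) ⇝ ∀t (neg φ)
    ¬∀c : ∀ {t c} {φ : Formula t (suc c)} → neg (∀c φ) ⇝ ∃c (neg φ)
    ¬∀t : ∀ {t c} {φ : Formula (suc t) c} → neg (∀t φ) ⇝ ∃t (neg φ)
    ∃c∨ : ∀ {t c} {φ : Formula t (suc c)} {ψ} → ∃c φ ∨ ψ ⇝ ∃c (φ ∨ ↑ᶜ ψ)
    ∃t∨ : ∀ {t c} {φ : Formula (suc t) c} {ψ} → ∃t φ ∨ ψ ⇝ ∃t (φ ∨ ↑ᵗ ψ)
    ∀c∨ : ∀ {t c} {φ : Formula t (suc c)} {ψ} → ∀c φ ∨ ψ ⇝ ∀c (φ ∨ ↑ᶜ ψ)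
    ∀t∨ : ∀ {t c} {φ : Formula (suc t) c} {ψ} → ∀t φ ∨ ψ ⇝ ∀t (φ ∨ ↑ᵗ ψ)
    ∨∃c : ∀ {t c} {φ : Formula t c} {ψ} → φ ∨ ∃c ψ ⇝ ∃c (↑ᶜ φ ∨ ψ)
    ∨∃t : ∀ {t c} {φ : Formula t c} {ψ} → φ ∨ ∃t ψ ⇝ ∃t (↑ᵗ φ ∨ ψ)
    ∨∀c : ∀ {t c} {φ : Formula t c} {ψ} → φ ∨ ∀c ψ ⇝ ∀c (↑ᶜ φ ∨ ψ)
    ∨∀t : ∀ {t c} {φ : Formula t c} {ψ} → φ ∨ ∀t ψ ⇝ ∀t (↑ᵗ φ ∨ ψ)
    neg : ∀ {t c} {φ φ′ : Formula t c} → φ ⇝ φ′ → neg φ ⇝ neg φ′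
    _∨ˡ : ∀ {t c} {φ φ′ ψ : Formula t c} → φ ⇝ φ′ → φ ∨ ψ ⇝ φ′ ∨ ψ
    ∨ʳ_ : ∀ {t c} {φ ψ ψ′ : Formula t c} → ψ ⇝ ψ′ → φ ∨ ψ ⇝ φ ∨ ψ′
    ∃c  : ∀ {t c} {φ φ′ : Formula t (suc c)} → φ ⇝ φ′ → ∃c φ ⇝ ∃c φ′
    ∃t  : ∀ {t c} {φ φ′ : Formula (suc t) c} → φ ⇝ φ′ → ∃t φ ⇝ ∃t φ′

  _⇝*_ : ∀ {t c} → Formula t c → Formula t c → Set
  _⇝*_ = Star _⇝_

  Fragment : Set₁
  Fragment = ∀ {t c} → Formula t c → Set

  -- The fragment Σₙ: formulas are classified through a prenex normal form.
  InΣ : ℕ → Fragment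
  InΣ n φ = ∃[ ψ ] (φ ⇝* ψ × PrenexΣ n ψ)

  -- A token variable occurs either inside a term δ k x or bare, i.e. as an
  -- argument of an equality or of a place predicate.
  data Occurrence : Set where
    under-δ bare : Occurrence

  data OccursT {t c : ℕ} (x : Fin t) : Term t c → Set where
    δ  : ∀ {k} → OccursT x (δ k x)
    op : ∀ {o ts} → Any (OccursT x) ts → OccursT x (op o ts)

  data Occurs : Occurrence → ∀ {t c} → Fin t → Formula t c → Set where
    ==ˡ : ∀ {t c} {x y : Fin t} → Occurs bare {c = c} x (x == y)
    ==ʳ : ∀ {t c} {x y : Fin t} → Occurs bare {c = c} y (x == y)
    at  : ∀ {t c p} {x : Fin t} → Occurs bare {c = c} x (at p x)
    rel : ∀ {t c r} {x : Fin t} {ts : Vec (Term t c) (arΞ r)} →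
          Any (OccursT x) ts → Occurs under-δ x (rel r ts)
    neg : ∀ {o t c} {x : Fin t} {φ : Formula t c} → Occurs o x φ → Occurs o x (neg φ)
    _∨ˡ : ∀ {o t c} {x : Fin t} {φ ψ : Formula t c} → Occurs o x φ → Occurs o x (φ ∨ ψ)
    ∨ʳ_ : ∀ {o t c} {x : Fin t} {φ ψ : Formula t c} → Occurs o x ψ → Occurs o x (φ ∨ ψ)
    ∃c  : ∀ {o t c} {x : Fin t} {φ : Formula t (suc c)} → Occurs o x φ → Occurs o x (∃c φ)
    ∃t  : ∀ {o t c} {x : Fin t} {φ : Formula (suc t) c} → Occurs o (suc x) φ → Occurs o x (∃t φ)

  _∈FV_ : ∀ {t c} → Fin t → Formula t c → Set
  x ∈FV φ = ∃[ o ] Occurs o x φ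

  -- The token variables of the guard are x₁ … xₙ (indices i ↑ˡ m) followed by
  -- y₁ … yₘ (indices n ↑ʳ j).
  record Transition : Set where
    field
      {n m}  : ℕ
      input  : Fin n → ℙ
      output : Fin m → ℙ
      guard  : Formula (n + m) 0
      all-FV : ∀ x → x ∈FV guard
      y-δ    : ∀ j → ¬ Occurs bare (n ↑ʳ j) guard

  CPN : Set
  CPN = List Transition

  CPN[_] : Fragment → Pred CPN 0ℓ
  CPN[ Θ ] = List.All (λ τ → Θ (Transition.guard τ))

  -- Replaces δ k y_j by the fresh color variable z_{j,k} of index combine j k.
  freshColors : ∀ n m → Subst (n + m) 0 (n + m) (m * N)
  freshColors n m = record
    { token = id
    ; colv  = λ ()
    ; delta = λ k x → [ (λ i → δ k (i ↑ˡ m)) , (λ j → var (combine j k)) ]′ (splitAt n x)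
    }

  record Fires (τ : Transition) (M M′ : Marking) : Set where
    open Transition τ
    field
      s           : Fin n → ℕ
      s′          : Fin m → ℕ
      s-distinct  : Injective _≡_ _≡_ s
      s′-distinct : Injective _≡_ _≡_ s′
      consumed    : ∀ i → place M (s i) ≡ just (input i) × place M′ (s i) ≡ nothing
      produced    : ∀ j → place M (s′ j) ≡ nothing × place M′ (s′ j) ≡ just (output j)
      unchanged   : ∀ u → (∀ i → u ≢ s i) → (∀ j → u ≢ s′ j) → M u ≡ M′ u
      -- After the substitution no y_j is left in the guard (by y-δ), so the
      -- values s′ given to them here are irrelevant.
      guarded     : Sat M (s F.++ s′)
                        (λ z → let (j , k) = remQuot {m} N z in color M′ k (s′ j))
                        (substF (freshColors n m) guard)

  _⊢_⟶_ : CPN → Marking → Marking → Set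
  S ⊢ M ⟶ M′ = List.Any (λ τ → Fires τ M M′) S

  post : CPN → Pred Marking 0ℓ → Pred Marking 0ℓ
  post S 𝓜 M′ = ∃[ M ] (M ∈ 𝓜 × S ⊢ M ⟶ M′)

  pre : CPN → Pred Marking 0ℓ → Pred Marking 0ℓ
  pre S 𝓜 M′ = ∃[ M ] (M ∈ 𝓜 × S ⊢ M′ ⟶ M)

  -- The formula has to be constructed outright, whereas its correctness is a
  -- statement of classical mathematics: excluded middle is available for
  -- proving the equality of the two sets, but not for finding the formula.
  EffectivelyDefinable : Fragment → Pred Marking 0ℓ → Set₁
  EffectivelyDefinable Θ 𝓜 =
    Σ[ ψ ∈ Closed ] Θ ψ × (ExcludedMiddle 0ℓ → 𝓜 ≐ ⟦ ψ ⟧)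

{-# OPTIONS --safe #-}

-- M and M′ with M → M′ by a transition differ only on the tokens it consumes and produces.
-- Hence a property of M is a property of M′ together with finitely many tokens (the changed
-- ones) and colors (theirs in M), and both can be quantified existentially: in each atom one
-- distinguishes whether a token is one of the changed ones, and then replaces its colors by
-- color variables and its place by a constant.  This rewrites the matrix only, so the prefix
-- of a Σ-formula survives, and the new existential quantifiers are absorbed by its outermost
-- block.  The same argument with M and M′ exchanged treats predecessors.
module Submission where

open import Defs
open import Axiom.ExcludedMiddle using (ExcludedMiddle)
open import Data.Fin using (Fin; zero; suc; _↑ˡ_; _↑ʳ_; splitAt; combine; remQuot; fromℕ<)
import Data.Fin.Properties as Fin
open import Data.List.Relation.Unary.All as All using (All; []; _∷_)
open import Data.List.Relation.Unary.Any as Any using (Any; here; there)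
open import Data.Maybe using (just; nothing)
import Data.Maybe.Properties as Maybe
open import Data.Nat using (ℕ; zero; suc; _+_; _*_; _≤_)
open import Data.Nat.Properties using (_≟_)
open import Data.Product using (∃; ∃-syntax; _×_; _,_; proj₁; proj₂)
open import Data.Product.Function.Dependent.Propositional using (Σ-⇔)
open import Data.Product.Function.NonDependent.Propositional using (_×-⇔_)
open import Data.Sum using (_⊎_; inj₁; inj₂; swap)
open import Data.Sum.Function.Propositional using (_⊎-⇔_)
open import Data.Unit using (⊤)
open import Data.Vec using (Vec; []; _∷_; lookup; tabulate)
import Data.Vec.Functional as F
open import Data.Vec.Functional.Properties using (lookup-++ˡ; lookup-++ʳ)
open import Data.Vec.Properties using (lookup∘tabulate; tabulate∘lookup; tabulate-cong)
open import Function using (id; _∘_)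
open import Function.Bundles using (_⇔_; mk⇔; module Equivalence)
open import Function.Construct.Composition using (_⇔-∘_)
open import Function.Construct.Identity using (⇔-id; ↠-id)
open import Function.Construct.Symmetry using (⇔-sym)
open import Function.Definitions using (Injective)
open import Function.Related.TypeIsomorphisms using (¬-cong-⇔)
open import Level using (0ℓ)
open import Relation.Binary.Construct.Closure.ReflexiveTransitive using (ε; _◅_; _◅◅_; gmap)
open import Relation.Binary.PropositionalEquality using (_≡_; _≢_; refl; sym; trans; cong; cong₂; subst)
open import Relation.Nullary using (¬_; Dec; yes; no; contradiction)
open import Relation.Nullary.Decidable using (decidable-stable)
open import Relation.Unary using (Pred; _∈_; _≐_)

open Equivalence using (to; from)

-- Membership in a fragment only provides conversion steps to a prenex formula, and a rewriting of
-- the matrix keeps the class of a formula only if that formula is prenex already. So the rewriting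
-- acts on the prenex forms, and conversion has to be shown to preserve meaning. Two points make
-- this delicate. Pulling an existential color quantifier out of a disjunction is sound only if `ℂ`
-- has an element; every marking supplies one, because `N` is positive. And the guard is converted
-- before its terms `δ k y` for produced tokens become fresh color variables, so soundness is needed
-- for valuations in which a token carries colors other than those it has in the marking. The two
-- images differ in where the guard is read: it speaks of `M`, with the new colors of `M′` as
-- parameters. For successors it has to be rewritten along with `φ`, and the new colors are read off
-- the marking at hand; for predecessors it is already about the marking at hand, and the new colors
-- are among the quantified ones.

∃-cong : {A : Set} {B C : A → Set} → (∀ a → B a ⇔ C a) → ∃ B ⇔ ∃ C
∃-cong B⇔C = Σ-⇔ (↠-id _) λ {a} → B⇔C a

∷-cong : {A : Set} {n : ℕ} {a : A} {f g : Fin n → A} →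
         (∀ i → f i ≡ g i) → ∀ i → (a F.∷ f) i ≡ (a F.∷ g) i
∷-cong f≗g zero    = refl
∷-cong f≗g (suc i) = f≗g i

head∷tail : {A : Set} {n : ℕ} (f : Fin (suc n) → A) → ∀ i → f i ≡ (F.head f F.∷ F.tail f) i
head∷tail f zero    = refl
head∷tail f (suc i) = refl

↑-elim : ∀ {n m} (X : Fin (n + m) → Set) →
         (∀ i → X (i ↑ˡ m)) → (∀ j → X (n ↑ʳ j)) → ∀ x → X x
↑-elim {n} {m} X l r x with splitAt n x in eq
... | inj₁ i = subst X (Fin.splitAt⁻¹-↑ˡ eq) (l i)
... | inj₂ j = subst X (Fin.splitAt⁻¹-↑ʳ eq) (r j)

≡⇒⇔ : {A B : Set} → A ≡ B → A ⇔ B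
≡⇒⇔ refl = ⇔-id _

module _ {I X : Set} {Q : X → Set} {R : I → X → Set} where

  -- With `Any-∃⁺`, exchanges the choice of a transition with that of a marking, so that the image
  -- under a net becomes the union of the images under its transitions.
  Any-∃⁻ : ∀ {S} → Any (λ i → ∃[ x ] (Q x × R i x)) S → ∃[ x ] (Q x × Any (λ i → R i x) S)
  Any-∃⁻ (here (x , q , r)) = x , q , here r
  Any-∃⁻ (there rs)         = let (x , q , rs′) = Any-∃⁻ rs in x , q , there rs′

  Any-∃⁺ : ∀ {S} → ∃[ x ] (Q x × Any (λ i → R i x) S) → Any (λ i → ∃[ x ] (Q x × R i x)) S
  Any-∃⁺ (x , q , rs) = Any.map (λ r → x , q , r) rs

-- When only `B` holds, the right-hand side still demands a witness, and `x₀` provides it.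
∃-⊎ : {X : Set} → X → {A B′ : X → Set} {B : Set} → (∀ x → B′ x ⇔ B) →
      (∃ A ⊎ B) ⇔ (∃ λ x → A x ⊎ B′ x)
∃-⊎ x₀ B′⇔B = mk⇔
  (λ { (inj₁ (x , a)) → x , inj₁ a ; (inj₂ b) → x₀ , inj₂ (from (B′⇔B x₀) b) })
  (λ { (x , inj₁ a) → inj₁ (x , a) ; (x , inj₂ b) → inj₂ (to (B′⇔B x) b) })

⊎-comm : {A B : Set} → (A ⊎ B) ⇔ (B ⊎ A)
⊎-comm = mk⇔ swap swap

⊎-∃ : {X : Set} → X → {A B′ : X → Set} {B : Set} → (∀ x → B′ x ⇔ B) →
      (B ⊎ ∃ A) ⇔ (∃ λ x → B′ x ⊎ A x)
⊎-∃ x₀ B′⇔B = (∃-cong λ _ → ⊎-comm) ⇔-∘ (∃-⊎ x₀ B′⇔B ⇔-∘ ⊎-comm)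

-- Classical equivalences behind prenex conversion

module _ (em : ExcludedMiddle 0ℓ) where

  dne : {A : Set} → ¬ ¬ A → A
  dne = decidable-stable em

  ¬∃⇔¬∃¬¬ : {X : Set} {A : X → Set} → (¬ ∃ A) ⇔ (¬ ∃ λ x → ¬ ¬ A x)
  ¬∃⇔¬∃¬¬ = ¬-cong-⇔ (∃-cong λ _ → mk⇔ contradiction dne)

  -- Backwards the disjunct has to be chosen uniformly in `x`, so `B` is decided first; if it fails,
  -- no `x` can refute `A`. Over an empty `X` both sides hold, in contrast with `∃-⊎`.
  ∀-⊎ : {X : Set} {A B′ : X → Set} {B : Set} → (∀ x → B′ x ⇔ B) →
        ((¬ ∃ λ x → ¬ A x) ⊎ B) ⇔ (¬ ∃ λ x → ¬ (A x ⊎ B′ x))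
  ∀-⊎ {A = A} {B = B} B′⇔B = mk⇔
    (λ { (inj₁ h) (x , k) → h (x , k ∘ inj₁) ; (inj₂ b) (x , k) → k (inj₂ (from (B′⇔B x) b)) })
    back
    where
    back : _
    back h with em {B}
    ... | yes b = inj₂ b
    ... | no ¬b = inj₁ λ (x , ¬a) → h (x , λ { (inj₁ a) → ¬a a ; (inj₂ b) → ¬b (to (B′⇔B x) b) })

  ⊎-∀ : {X : Set} {A B′ : X → Set} {B : Set} → (∀ x → B′ x ⇔ B) →
        (B ⊎ (¬ ∃ λ x → ¬ A x)) ⇔ (¬ ∃ λ x → ¬ (B′ x ⊎ A x))
  ⊎-∀ B′⇔B = (¬-cong-⇔ (∃-cong λ _ → ¬-cong-⇔ ⊎-comm)) ⇔-∘ (∀-⊎ B′⇔B ⇔-∘ ⊎-comm)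

  ¬⊎¬⇔× : {A B : Set} → (¬ (¬ A ⊎ ¬ B)) ⇔ (A × B)
  ¬⊎¬⇔× = mk⇔
    (λ h → dne (h ∘ inj₁) , dne (h ∘ inj₂))
    (λ { (a , b) (inj₁ ¬a) → ¬a a ; (a , b) (inj₂ ¬b) → ¬b b })

module Development (P N : ℕ) (𝒞 : ColorStructure) where

  open ColorStructure 𝒞
  open CML P N 𝒞

  private variable
    t c t′ c′ : ℕ

  -- Prenex classes

  -- A map that commutes with `neg` and both quantifiers can alter a prenex formula only in its
  -- matrix. The argument is abstract because it serves both `substF` and `relocate`, whose
  -- environments differ.
  module PreservesPrenex
    (E : (t c t′ c′ : ℕ) → Set)
    (liftT : ∀ {t c t′ c′} → E t c t′ c′ → E (suc t) c (suc t′) c′)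
    (liftC : ∀ {t c t′ c′} → E t c t′ c′ → E t (suc c) t′ (suc c′))
    (f : ∀ {t c t′ c′} → E t c t′ c′ → Formula t c → Formula t′ c′)
    (f-neg : ∀ {t c t′ c′} (σ : E t c t′ c′) φ → f σ (neg φ) ≡ neg (f σ φ))
    (f-∃c : ∀ {t c t′ c′} (σ : E t c t′ c′) φ → f σ (∃c φ) ≡ ∃c (f (liftC σ) φ))
    (f-∃t : ∀ {t c t′ c′} (σ : E t c t′ c′) φ → f σ (∃t φ) ≡ ∃t (f (liftT σ) φ))
    (f-QF : ∀ {t c t′ c′} (σ : E t c t′ c′) {φ} → QuantifierFree φ → QuantifierFree (f σ φ))
    where

    f-∀c : (σ : E t c t′ c′) (φ : Formula t (suc c)) → f σ (∀c φ) ≡ ∀c (f (liftC σ) φ)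
    f-∀c σ φ = trans (f-neg σ _) (cong neg (trans (f-∃c σ _) (cong ∃c (f-neg _ φ))))

    f-∀t : (σ : E t c t′ c′) (φ : Formula (suc t) c) → f σ (∀t φ) ≡ ∀t (f (liftT σ) φ)
    f-∀t σ φ = trans (f-neg σ _) (cong neg (trans (f-∃t σ _) (cong ∃t (f-neg _ φ))))

    preserves-ColorPrenex : (σ : E t c t′ c′) {φ : Formula t c} →
                            ColorPrenex φ → ColorPrenex (f σ φ)
    preserves-ColorPrenex σ (matrix q)          = matrix (f-QF σ q)
    preserves-ColorPrenex σ (∃c {φ = φ} p)
      rewrite f-∃c σ φ = ∃c (preserves-ColorPrenex (liftC σ) p)
    preserves-ColorPrenex σ (all-c {φ = φ} p)
      rewrite f-∀c σ φ = all-c (preserves-ColorPrenex (liftC σ) p)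

    mutual
      preserves-Σ : ∀ {n} (σ : E t c t′ c′) {φ : Formula t c} → PrenexΣ n φ → PrenexΣ n (f σ φ)
      preserves-Σ σ (level₀ p) = level₀ (preserves-ColorPrenex σ p)
      preserves-Σ σ (inner p)  = inner (preserves-Π σ p)
      preserves-Σ σ (∃c {φ = φ} p) rewrite f-∃c σ φ = ∃c (preserves-Σ (liftC σ) p)
      preserves-Σ σ (∃t {φ = φ} p) rewrite f-∃t σ φ = ∃t (preserves-Σ (liftT σ) p)

      preserves-Π : ∀ {n} (σ : E t c t′ c′) {φ : Formula t c} → PrenexΠ n φ → PrenexΠ n (f σ φ)
      preserves-Π σ (level₀ p) = level₀ (preserves-ColorPrenex σ p)
      preserves-Π σ (inner p)  = inner (preserves-Σ σ p)
      preserves-Π σ (all-c {φ = φ} p) rewrite f-∀c σ φ = all-c (preserves-Π (liftC σ) p)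
      preserves-Π σ (all-t {φ = φ} p) rewrite f-∀t σ φ = all-t (preserves-Π (liftT σ) p)

  substF-QF : (σ : Subst t c t′ c′) {φ : Formula t c} →
              QuantifierFree φ → QuantifierFree (substF σ φ)
  substF-QF σ true       = true
  substF-QF σ (x == y)   = _ == _
  substF-QF σ (at p x)   = at _ _
  substF-QF σ (rel r ts) = rel _ _
  substF-QF σ (neg q)    = neg (substF-QF σ q)
  substF-QF σ (q ∨ q′)   = substF-QF σ q ∨ substF-QF σ q′

  open PreservesPrenex Subst liftᵗ liftᶜ substF
    (λ _ _ → refl) (λ _ _ → refl) (λ _ _ → refl) substF-QF
    using () renaming
      ( preserves-ColorPrenex to substF-ColorPrenex
      ; preserves-Σ to substF-Σ
      ; preserves-Π to substF-Π
      )

  mutual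
    QF⇒Σ : ∀ n {φ : Formula t c} → QuantifierFree φ → PrenexΣ n φ
    QF⇒Σ zero    q = level₀ (matrix q)
    QF⇒Σ (suc n) q = inner (QF⇒Π n q)

    QF⇒Π : ∀ n {φ : Formula t c} → QuantifierFree φ → PrenexΠ n φ
    QF⇒Π zero    q = level₀ (matrix q)
    QF⇒Π (suc n) q = inner (QF⇒Σ n q)

  Reduces : (Formula t c → Set) → Formula t c → Set
  Reduces X φ = ∃[ ψ ] (φ ⇝* ψ × X ψ)

  InΠ : ℕ → Fragment
  InΠ n = Reduces (PrenexΠ n)

  reduce : {X : Formula t c → Set} {φ φ′ : Formula t c} →
           φ ⇝* φ′ → Reduces X φ′ → Reduces X φ
  reduce r (ψ , r′ , x) = ψ , r ◅◅ r′ , x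

  relax : {X Y : Formula t c → Set} {φ : Formula t c} →
          (∀ {ψ} → X ψ → Y ψ) → Reduces X φ → Reduces Y φ
  relax g (ψ , r , x) = ψ , r , g x

  module _ {X : Formula t (suc c) → Set} {Y : Formula t c → Set} {φ : Formula t (suc c)} where

    under-∃c : (∀ {ψ} → X ψ → Y (∃c ψ)) → Reduces X φ → Reduces Y (∃c φ)
    under-∃c g (ψ , r , x) = ∃c ψ , gmap ∃c ∃c r , g x

    under-∀c : (∀ {ψ} → X ψ → Y (∀c ψ)) → Reduces X φ → Reduces Y (∀c φ)
    under-∀c g (ψ , r , x) = ∀c ψ , gmap (λ χ → ∀c χ) (λ s → neg (∃c (neg s))) r , g x

  module _ {X : Formula (suc t) c → Set} {Y : Formula t c → Set} {φ : Formula (suc t) c} where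

    under-∃t : (∀ {ψ} → X ψ → Y (∃t ψ)) → Reduces X φ → Reduces Y (∃t φ)
    under-∃t g (ψ , r , x) = ∃t ψ , gmap ∃t ∃t r , g x

    under-∀t : (∀ {ψ} → X ψ → Y (∀t ψ)) → Reduces X φ → Reduces Y (∀t φ)
    under-∀t g (ψ , r , x) = ∀t ψ , gmap (λ χ → ∀t χ) (λ s → neg (∃t (neg s))) r , g x

  neg-ColorPrenex : {φ : Formula t c} → ColorPrenex φ → Reduces ColorPrenex (neg φ)
  neg-ColorPrenex (matrix q) = _ , ε , matrix (neg q)
  neg-ColorPrenex (∃c p)     = reduce (¬∃c ◅ ε) (under-∀c all-c (neg-ColorPrenex p))
  neg-ColorPrenex (all-c p)  = reduce (¬∀c ◅ ε) (under-∃c ∃c (neg-ColorPrenex p))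

  mutual
    neg-Σ : ∀ {n} {φ : Formula t c} → PrenexΣ n φ → InΠ n (neg φ)
    neg-Σ (level₀ p) = relax level₀ (neg-ColorPrenex p)
    neg-Σ (inner p)  = relax inner (neg-Π p)
    neg-Σ (∃c p)     = reduce (¬∃c ◅ ε) (under-∀c all-c (neg-Σ p))
    neg-Σ (∃t p)     = reduce (¬∃t ◅ ε) (under-∀t all-t (neg-Σ p))

    neg-Π : ∀ {n} {φ : Formula t c} → PrenexΠ n φ → InΣ n (neg φ)
    neg-Π (level₀ p) = relax level₀ (neg-ColorPrenex p)
    neg-Π (inner p)  = relax inner (neg-Σ p)
    neg-Π (all-c p)  = reduce (¬∀c ◅ ε) (under-∃c ∃c (neg-Π p))
    neg-Π (all-t p)  = reduce (¬∀t ◅ ε) (under-∃t ∃t (neg-Π p))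

  QF-∨-ColorPrenex : {φ ψ : Formula t c} →
                     QuantifierFree φ → ColorPrenex ψ → Reduces ColorPrenex (φ ∨ ψ)
  QF-∨-ColorPrenex q (matrix q′) = _ , ε , matrix (q ∨ q′)
  QF-∨-ColorPrenex q (∃c p)      =
    reduce (∨∃c ◅ ε) (under-∃c ∃c (QF-∨-ColorPrenex (substF-QF wkᶜ q) p))
  QF-∨-ColorPrenex q (all-c p)   =
    reduce (∨∀c ◅ ε) (under-∀c all-c (QF-∨-ColorPrenex (substF-QF wkᶜ q) p))

  -- At level 0 color quantifiers may alternate freely, so the two prefixes are simply pulled out
  -- one after the other; the higher levels must merge them block by block.
  ∨-ColorPrenex : {φ ψ : Formula t c} →
                  ColorPrenex φ → ColorPrenex ψ → Reduces ColorPrenex (φ ∨ ψ)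
  ∨-ColorPrenex (matrix q) p′ = QF-∨-ColorPrenex q p′
  ∨-ColorPrenex (∃c p)     p′ =
    reduce (∃c∨ ◅ ε) (under-∃c ∃c (∨-ColorPrenex p (substF-ColorPrenex wkᶜ p′)))
  ∨-ColorPrenex (all-c p)  p′ =
    reduce (∀c∨ ◅ ε) (under-∀c all-c (∨-ColorPrenex p (substF-ColorPrenex wkᶜ p′)))

  -- The block of the left disjunct is pulled out first, then that of the right one.
  mutual
    ∨-Σ : ∀ n {φ ψ : Formula t c} → PrenexΣ n φ → PrenexΣ n ψ → InΣ n (φ ∨ ψ)
    ∨-Σ zero    (level₀ p) (level₀ p′) = relax level₀ (∨-ColorPrenex p p′)
    ∨-Σ (suc n) (inner p)  p′          = Π-∨-Σ n p p′
    ∨-Σ (suc n) (∃c p)     p′          =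
      reduce (∃c∨ ◅ ε) (under-∃c ∃c (∨-Σ (suc n) p (substF-Σ wkᶜ p′)))
    ∨-Σ (suc n) (∃t p)     p′          =
      reduce (∃t∨ ◅ ε) (under-∃t ∃t (∨-Σ (suc n) p (substF-Σ wkᵗ p′)))

    Π-∨-Σ : ∀ n {φ ψ : Formula t c} → PrenexΠ n φ → PrenexΣ (suc n) ψ → InΣ (suc n) (φ ∨ ψ)
    Π-∨-Σ n p (inner p′) = relax inner (∨-Π n p p′)
    Π-∨-Σ n p (∃c p′)    = reduce (∨∃c ◅ ε) (under-∃c ∃c (Π-∨-Σ n (substF-Π wkᶜ p) p′))
    Π-∨-Σ n p (∃t p′)    = reduce (∨∃t ◅ ε) (under-∃t ∃t (Π-∨-Σ n (substF-Π wkᵗ p) p′))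

    ∨-Π : ∀ n {φ ψ : Formula t c} → PrenexΠ n φ → PrenexΠ n ψ → InΠ n (φ ∨ ψ)
    ∨-Π zero    (level₀ p) (level₀ p′) = relax level₀ (∨-ColorPrenex p p′)
    ∨-Π (suc n) (inner p)  p′          = Σ-∨-Π n p p′
    ∨-Π (suc n) (all-c p)  p′          =
      reduce (∀c∨ ◅ ε) (under-∀c all-c (∨-Π (suc n) p (substF-Π wkᶜ p′)))
    ∨-Π (suc n) (all-t p)  p′          =
      reduce (∀t∨ ◅ ε) (under-∀t all-t (∨-Π (suc n) p (substF-Π wkᵗ p′)))

    Σ-∨-Π : ∀ n {φ ψ : Formula t c} → PrenexΣ n φ → PrenexΠ (suc n) ψ → InΠ (suc n) (φ ∨ ψ)
    Σ-∨-Π n p (inner p′) = relax inner (∨-Σ n p p′)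
    Σ-∨-Π n p (all-c p′) = reduce (∨∀c ◅ ε) (under-∀c all-c (Σ-∨-Π n (substF-Σ wkᶜ p) p′))
    Σ-∨-Π n p (all-t p′) = reduce (∨∀t ◅ ε) (under-∀t all-t (Σ-∨-Π n (substF-Σ wkᵗ p) p′))

  ⇝*-∨ : {φ φ′ ψ ψ′ : Formula t c} → φ ⇝* φ′ → ψ ⇝* ψ′ → φ ∨ ψ ⇝* φ′ ∨ ψ′
  ⇝*-∨ {φ′ = φ′} {ψ = ψ} r s = gmap (_∨ ψ) _∨ˡ r ◅◅ gmap (φ′ ∨_) ∨ʳ_ s

  InΣ-∨ : ∀ {n} {φ ψ : Formula t c} → InΣ n φ → InΣ n ψ → InΣ n (φ ∨ ψ)
  InΣ-∨ (_ , r , p) (_ , s , q) = reduce (⇝*-∨ r s) (∨-Σ _ p q)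

  InΠ-∨ : ∀ {n} {φ ψ : Formula t c} → InΠ n φ → InΠ n ψ → InΠ n (φ ∨ ψ)
  InΠ-∨ (_ , r , p) (_ , s , q) = reduce (⇝*-∨ r s) (∨-Π _ p q)

  InΣ-neg : ∀ {n} {φ : Formula t c} → InΣ n φ → InΠ n (neg φ)
  InΣ-neg (_ , r , p) = reduce (gmap neg neg r) (neg-Σ p)

  InΠ-neg : ∀ {n} {φ : Formula t c} → InΠ n φ → InΣ n (neg φ)
  InΠ-neg (_ , r , p) = reduce (gmap neg neg r) (neg-Π p)

  infixr 6 _∧_

  _∧_ : Formula t c → Formula t c → Formula t c
  φ ∧ ψ = neg (neg φ ∨ neg ψ)

  -- Unfolding `_∧_` leads from Σ to Π under the inner negations and back under the outer one, so
  -- the closure under disjunction used here is that of Π.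
  InΣ-∧ : ∀ {n} {φ ψ : Formula t c} → InΣ n φ → InΣ n ψ → InΣ n (φ ∧ ψ)
  InΣ-∧ i j = InΠ-neg (InΠ-∨ (InΣ-neg i) (InΣ-neg j))

  QF-∧ : {φ ψ : Formula t c} → QuantifierFree φ → QuantifierFree ψ → QuantifierFree (φ ∧ ψ)
  QF-∧ p q = neg (neg p ∨ neg q)

  InΣ-∃c : ∀ {n} {φ : Formula t (suc c)} → InΣ (suc n) φ → InΣ (suc n) (∃c φ)
  InΣ-∃c = under-∃c ∃c

  InΣ-∃t : ∀ {n} {φ : Formula (suc t) c} → InΣ (suc n) φ → InΣ (suc n) (∃t φ)
  InΣ-∃t = under-∃t ∃t

  -- Satisfaction with the colors of the free token variables detached from the marking

  Token : Set
  Token = ℕ × Vec ℂ N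

  tokenIn : Marking → ℕ → Token
  tokenIn M s = s , proj₂ (M s)

  module _ (θ : Fin t → Token) (ν : Fin c → ℂ) where
    mutual
      eval⋆ : Term t c → ℂ
      eval⋆ (var z)   = ν z
      eval⋆ (δ k x)   = lookup (proj₂ (θ x)) k
      eval⋆ (op o ts) = opΩ o (evals⋆ ts)

      evals⋆ : ∀ {n} → Vec (Term t c) n → Vec ℂ n
      evals⋆ []       = []
      evals⋆ (u ∷ us) = eval⋆ u ∷ evals⋆ us

  -- A substitution may separate the color of a token variable from its value (freshColors
  -- does so), hence it can be undone on the valuation only if the two are independent.
  Sat⋆ : Marking → (Fin t → Token) → (Fin c → ℂ) → Formula t c → Set
  Sat⋆ M θ ν true       = ⊤
  Sat⋆ M θ ν (x == y)   = proj₁ (θ x) ≡ proj₁ (θ y)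
  Sat⋆ M θ ν (at p x)   = place M (proj₁ (θ x)) ≡ p
  Sat⋆ M θ ν (rel r ts) = relΞ r (evals⋆ θ ν ts)
  Sat⋆ M θ ν (neg φ)    = ¬ Sat⋆ M θ ν φ
  Sat⋆ M θ ν (φ ∨ ψ)    = Sat⋆ M θ ν φ ⊎ Sat⋆ M θ ν ψ
  Sat⋆ M θ ν (∃c φ)     = ∃[ d ] Sat⋆ M θ (d F.∷ ν) φ
  Sat⋆ M θ ν (∃t φ)     = ∃[ s ] Sat⋆ M (tokenIn M s F.∷ θ) ν φ

  module _ (M : Marking) {θ : Fin t → ℕ} {θ⋆ : Fin t → Token} {ν ν⋆ : Fin c → ℂ}
           (θ-eq : ∀ x → θ⋆ x ≡ tokenIn M (θ x)) (ν-eq : ∀ z → ν⋆ z ≡ ν z) where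
    mutual
      eval⋆-eval : (u : Term t c) → eval⋆ θ⋆ ν⋆ u ≡ eval M θ ν u
      eval⋆-eval (var z)   = ν-eq z
      eval⋆-eval (δ k x)   = cong (λ τ → lookup (proj₂ τ) k) (θ-eq x)
      eval⋆-eval (op o ts) = cong (opΩ o) (evals⋆-evals ts)

      evals⋆-evals : ∀ {n} (us : Vec (Term t c) n) → evals⋆ θ⋆ ν⋆ us ≡ evals M θ ν us
      evals⋆-evals []       = refl
      evals⋆-evals (u ∷ us) = cong₂ _∷_ (eval⋆-eval u) (evals⋆-evals us)

  Sat⋆⇔Sat : ∀ M {θ : Fin t → ℕ} {θ⋆ : Fin t → Token} {ν ν⋆ : Fin c → ℂ} →
             (∀ x → θ⋆ x ≡ tokenIn M (θ x)) → (∀ z → ν⋆ z ≡ ν z) →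
             ∀ φ → Sat⋆ M θ⋆ ν⋆ φ ⇔ Sat M θ ν φ
  Sat⋆⇔Sat M θ-eq ν-eq true       = ⇔-id _
  Sat⋆⇔Sat M θ-eq ν-eq (x == y)   =
    ≡⇒⇔ (cong₂ _≡_ (cong proj₁ (θ-eq x)) (cong proj₁ (θ-eq y)))
  Sat⋆⇔Sat M θ-eq ν-eq (at p x)   = ≡⇒⇔ (cong (λ τ → place M (proj₁ τ) ≡ p) (θ-eq x))
  Sat⋆⇔Sat M θ-eq ν-eq (rel r ts) = ≡⇒⇔ (cong (relΞ r) (evals⋆-evals M θ-eq ν-eq ts))
  Sat⋆⇔Sat M θ-eq ν-eq (neg φ)    = ¬-cong-⇔ (Sat⋆⇔Sat M θ-eq ν-eq φ)
  Sat⋆⇔Sat M θ-eq ν-eq (φ ∨ ψ)    = Sat⋆⇔Sat M θ-eq ν-eq φ ⊎-⇔ Sat⋆⇔Sat M θ-eq ν-eq ψ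
  Sat⋆⇔Sat M θ-eq ν-eq (∃c φ)     = ∃-cong λ d → Sat⋆⇔Sat M θ-eq (∷-cong ν-eq) φ
  Sat⋆⇔Sat M θ-eq ν-eq (∃t φ)     =
    ∃-cong λ s → Sat⋆⇔Sat M (λ { zero → refl ; (suc x) → θ-eq x }) ν-eq φ

  Sat-cong : ∀ M {θ θ′ : Fin t → ℕ} {ν ν′ : Fin c → ℂ} →
             (∀ x → θ x ≡ θ′ x) → (∀ z → ν z ≡ ν′ z) → ∀ φ → Sat M θ ν φ ⇔ Sat M θ′ ν′ φ
  Sat-cong M θ≗θ′ ν≗ν′ φ =
    Sat⋆⇔Sat M (λ x → cong (tokenIn M) (θ≗θ′ x)) ν≗ν′ φ
    ⇔-∘ ⇔-sym (Sat⋆⇔Sat M (λ _ → refl) (λ _ → refl) φ)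

  module _ (σ : Subst t c t′ c′) {θ′ : Fin t′ → Token} {ν′ : Fin c′ → ℂ}
           {θ : Fin t → Token} {ν : Fin c → ℂ}
           (colv-eq : ∀ z → eval⋆ θ′ ν′ (Subst.colv σ z) ≡ ν z)
           (delta-eq : ∀ k x → eval⋆ θ′ ν′ (Subst.delta σ k x) ≡ lookup (proj₂ (θ x)) k) where
    mutual
      eval⋆-substT : (u : Term t c) → eval⋆ θ′ ν′ (substT σ u) ≡ eval⋆ θ ν u
      eval⋆-substT (var z)   = colv-eq z
      eval⋆-substT (δ k x)   = delta-eq k x
      eval⋆-substT (op o ts) = cong (opΩ o) (evals⋆-substTs ts)

      evals⋆-substTs : ∀ {n} (us : Vec (Term t c) n) → evals⋆ θ′ ν′ (substTs σ us) ≡ evals⋆ θ ν us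
      evals⋆-substTs []       = refl
      evals⋆-substTs (u ∷ us) = cong₂ _∷_ (eval⋆-substT u) (evals⋆-substTs us)

  Sat⋆-substF : ∀ M (σ : Subst t c t′ c′) {θ′ ν′ θ ν} →
                (∀ x → proj₁ (θ′ (Subst.token σ x)) ≡ proj₁ (θ x)) →
                (∀ z → eval⋆ θ′ ν′ (Subst.colv σ z) ≡ ν z) →
                (∀ k x → eval⋆ θ′ ν′ (Subst.delta σ k x) ≡ lookup (proj₂ (θ x)) k) →
                ∀ φ → Sat⋆ M θ′ ν′ (substF σ φ) ⇔ Sat⋆ M θ ν φ
  Sat⋆-substF M σ t-eq c-eq d-eq true       = ⇔-id _
  Sat⋆-substF M σ t-eq c-eq d-eq (x == y)   = ≡⇒⇔ (cong₂ _≡_ (t-eq x) (t-eq y))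
  Sat⋆-substF M σ t-eq c-eq d-eq (at p x)   = ≡⇒⇔ (cong (λ s → place M s ≡ p) (t-eq x))
  Sat⋆-substF M σ t-eq c-eq d-eq (rel r ts) =
    ≡⇒⇔ (cong (relΞ r) (evals⋆-substTs σ c-eq d-eq ts))
  Sat⋆-substF M σ t-eq c-eq d-eq (neg φ)    = ¬-cong-⇔ (Sat⋆-substF M σ t-eq c-eq d-eq φ)
  Sat⋆-substF M σ t-eq c-eq d-eq (φ ∨ ψ)    =
    Sat⋆-substF M σ t-eq c-eq d-eq φ ⊎-⇔ Sat⋆-substF M σ t-eq c-eq d-eq ψ
  Sat⋆-substF M σ {θ′} {ν′} t-eq c-eq d-eq (∃c φ) = ∃-cong λ d →
    -- Weakening a term leaves its value unchanged, so the hypotheses on `σ` pass to the lifted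
    -- substitution.
    let weaken = eval⋆-substT wkᶜ {θ′} {d F.∷ ν′} {θ′} {ν′} (λ _ → refl) (λ _ _ → refl)
    in Sat⋆-substF M (liftᶜ σ) t-eq
         (λ { zero → refl ; (suc z) → trans (weaken (Subst.colv σ z)) (c-eq z) })
         (λ k x → trans (weaken (Subst.delta σ k x)) (d-eq k x)) φ
  Sat⋆-substF M σ {θ′} {ν′} t-eq c-eq d-eq (∃t φ) = ∃-cong λ s →
    let weaken = eval⋆-substT wkᵗ {tokenIn M s F.∷ θ′} {ν′} {θ′} {ν′} (λ _ → refl) (λ _ _ → refl)
    in Sat⋆-substF M (liftᵗ σ)
         (λ { zero → refl ; (suc x) → t-eq x })
         (λ z → trans (weaken (Subst.colv σ z)) (c-eq z))
         (λ { k zero → refl ; k (suc x) → trans (weaken (Subst.delta σ k x)) (d-eq k x) }) φ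

  Sat⋆-↑ᶜ : ∀ M {θ : Fin t → Token} {ν : Fin c → ℂ} {d} φ →
            Sat⋆ M θ (d F.∷ ν) (↑ᶜ φ) ⇔ Sat⋆ M θ ν φ
  Sat⋆-↑ᶜ M = Sat⋆-substF M wkᶜ (λ _ → refl) (λ _ → refl) (λ _ _ → refl)

  Sat⋆-↑ᵗ : ∀ M {θ : Fin t → Token} {ν : Fin c → ℂ} {τ} φ →
            Sat⋆ M (τ F.∷ θ) ν (↑ᵗ φ) ⇔ Sat⋆ M θ ν φ
  Sat⋆-↑ᵗ M = Sat⋆-substF M wkᵗ (λ _ → refl) (λ _ → refl) (λ _ _ → refl)

  module _ (em : ExcludedMiddle 0ℓ) where

    -- Pulling ∃c out of a disjunction is sound only over a nonempty color domain.
    ⇝-sound : ℂ → ∀ M {φ φ′ : Formula t c} → φ ⇝ φ′ → ∀ θ ν → Sat⋆ M θ ν φ ⇔ Sat⋆ M θ ν φ′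
    ⇝-sound d M ¬∃c                θ ν = ¬∃⇔¬∃¬¬ em
    ⇝-sound d M ¬∃t                θ ν = ¬∃⇔¬∃¬¬ em
    ⇝-sound d M ¬∀c                θ ν = mk⇔ (dne em) contradiction
    ⇝-sound d M ¬∀t                θ ν = mk⇔ (dne em) contradiction
    ⇝-sound d M (∃c∨ {ψ = ψ})      θ ν = ∃-⊎ d λ _ → Sat⋆-↑ᶜ M ψ
    ⇝-sound d M (∃t∨ {ψ = ψ})      θ ν = ∃-⊎ 0 λ _ → Sat⋆-↑ᵗ M ψ
    ⇝-sound d M (∀c∨ {ψ = ψ})      θ ν = ∀-⊎ em λ _ → Sat⋆-↑ᶜ M ψ
    ⇝-sound d M (∀t∨ {ψ = ψ})      θ ν = ∀-⊎ em λ _ → Sat⋆-↑ᵗ M ψ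
    ⇝-sound d M (∨∃c {φ = φ})      θ ν = ⊎-∃ d λ _ → Sat⋆-↑ᶜ M φ
    ⇝-sound d M (∨∃t {φ = φ})      θ ν = ⊎-∃ 0 λ _ → Sat⋆-↑ᵗ M φ
    ⇝-sound d M (∨∀c {φ = φ})      θ ν = ⊎-∀ em λ _ → Sat⋆-↑ᶜ M φ
    ⇝-sound d M (∨∀t {φ = φ})      θ ν = ⊎-∀ em λ _ → Sat⋆-↑ᵗ M φ
    ⇝-sound d M (neg r)            θ ν = ¬-cong-⇔ (⇝-sound d M r θ ν)
    ⇝-sound d M (r ∨ˡ)             θ ν = ⇝-sound d M r θ ν ⊎-⇔ ⇔-id _
    ⇝-sound d M (∨ʳ r)             θ ν = ⇔-id _ ⊎-⇔ ⇝-sound d M r θ ν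
    ⇝-sound d M (∃c r)             θ ν = ∃-cong λ e → ⇝-sound d M r θ (e F.∷ ν)
    ⇝-sound d M (∃t r)             θ ν = ∃-cong λ s → ⇝-sound d M r (tokenIn M s F.∷ θ) ν

    ⇝*-sound : ℂ → ∀ M {φ φ′ : Formula t c} → φ ⇝* φ′ → ∀ θ ν → Sat⋆ M θ ν φ ⇔ Sat⋆ M θ ν φ′
    ⇝*-sound d M ε        θ ν = ⇔-id _
    ⇝*-sound d M (r ◅ rs) θ ν = ⇝*-sound d M rs θ ν ⇔-∘ ⇝-sound d M r θ ν

  -- Restating properties of a marking O on a marking B that differs from it on K tokens only

  module _ (M : Marking) (σ : Subst t c t′ c′) {θ′ : Fin t′ → ℕ} {ν′ : Fin c′ → ℂ}
           {θ : Fin t → ℕ} {ν : Fin c → ℂ}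
           (colv-eq : ∀ z → eval M θ′ ν′ (Subst.colv σ z) ≡ ν z)
           (delta-eq : ∀ k x → eval M θ′ ν′ (Subst.delta σ k x) ≡ color M k (θ x)) where

    private
      detach : (u : Term t′ c′) → eval⋆ (tokenIn M ∘ θ′) ν′ u ≡ eval M θ′ ν′ u
      detach = eval⋆-eval M (λ _ → refl) (λ _ → refl)

      colv-eq⋆ : ∀ z → eval⋆ (tokenIn M ∘ θ′) ν′ (Subst.colv σ z) ≡ ν z
      colv-eq⋆ z = trans (detach (Subst.colv σ z)) (colv-eq z)

      delta-eq⋆ : ∀ k x → eval⋆ (tokenIn M ∘ θ′) ν′ (Subst.delta σ k x) ≡ color M k (θ x)
      delta-eq⋆ k x = trans (detach (Subst.delta σ k x)) (delta-eq k x)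

    eval-substT : ∀ u → eval M θ′ ν′ (substT σ u) ≡ eval M θ ν u
    eval-substT u = trans (sym (detach (substT σ u)))
      (trans (eval⋆-substT σ {θ = tokenIn M ∘ θ} colv-eq⋆ delta-eq⋆ u)
        (eval⋆-eval M (λ _ → refl) (λ _ → refl) u))

    evals-substTs : ∀ {n} (us : Vec (Term t c) n) →
                    evals M θ′ ν′ (substTs σ us) ≡ evals M θ ν us
    evals-substTs []       = refl
    evals-substTs (u ∷ us) = cong₂ _∷_ (eval-substT u) (evals-substTs us)

  evals-tabulate : ∀ M (θ : Fin t → ℕ) (ν : Fin c → ℂ) {n} (f : Fin n → Term t c) →
                   evals M θ ν (tabulate f) ≡ tabulate (eval M θ ν ∘ f)
  evals-tabulate M θ ν {zero}  f = refl
  evals-tabulate M θ ν {suc n} f = cong (eval M θ ν (f zero) ∷_) (evals-tabulate M θ ν (f ∘ suc))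

  lookup-evals : ∀ M (θ : Fin t → ℕ) (ν : Fin c → ℂ) {n} (us : Vec (Term t c) n) k →
                 lookup (evals M θ ν us) k ≡ eval M θ ν (lookup us k)
  lookup-evals M θ ν (u ∷ us) zero    = refl
  lookup-evals M θ ν (u ∷ us) (suc k) = lookup-evals M θ ν us k

  _≟ᴸ_ : (l l′ : Location) → Dec (l ≡ l′)
  _≟ᴸ_ = Maybe.≡-dec Fin._≟_

  -- A cascade of if-then-else in which the first mark equal to `x` decides. Being quantifier-free
  -- whenever its branches are, it can replace an atom of the matrix.
  cases : ∀ k → (Fin k → Fin t) → Fin t → (Fin k → Formula t c) → Formula t c → Formula t c
  cases zero    mark x φ ψ = ψ
  cases (suc k) mark x φ ψ =
    ((x == mark zero) ∧ φ zero) ∨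
    (neg (x == mark zero) ∧ cases k (mark ∘ suc) x (φ ∘ suc) ψ)

  cases-QF : ∀ k {mark : Fin k → Fin t} {x} {φ : Fin k → Formula t c} {ψ} →
             (∀ i → QuantifierFree (φ i)) → QuantifierFree ψ → QuantifierFree (cases k mark x φ ψ)
  cases-QF zero    φ-QF ψ-QF = ψ-QF
  cases-QF (suc k) φ-QF ψ-QF =
    QF-∧ (_ == _) (φ-QF zero) ∨ QF-∧ (neg (_ == _)) (cases-QF k (φ-QF ∘ suc) ψ-QF)

  module _ (em : ExcludedMiddle 0ℓ) where

    -- Each branch has to express the same `A`, but only under the condition that selects it.
    -- Equality of tokens is decidable, so one walks down to the branch taken; excluded middle
    -- merely unfolds the encoded conjunctions.
    Sat-cases : ∀ M (θ : Fin t → ℕ) (ν : Fin c → ℂ) k {mark : Fin k → Fin t} {x φ ψ} {A : Set} →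
                (∀ i → θ x ≡ θ (mark i) → Sat M θ ν (φ i) ⇔ A) →
                ((∀ i → θ x ≢ θ (mark i)) → Sat M θ ν ψ ⇔ A) →
                Sat M θ ν (cases k mark x φ ψ) ⇔ A
    Sat-cases M θ ν zero marked other = other λ ()
    Sat-cases M θ ν (suc k) {mark} {x} marked other with θ x ≟ θ (mark zero)
    ... | yes eq = mk⇔
      (λ { (inj₁ h) → to (marked zero eq) (proj₂ (to (¬⊎¬⇔× em) h))
         ; (inj₂ h) → contradiction eq (proj₁ (to (¬⊎¬⇔× em) h)) })
      (λ a → inj₁ (from (¬⊎¬⇔× em) (eq , from (marked zero eq) a)))
    ... | no ¬eq = mk⇔
      (λ { (inj₁ h) → contradiction (proj₁ (to (¬⊎¬⇔× em) h)) ¬eq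
         ; (inj₂ h) → to rest (proj₂ (to (¬⊎¬⇔× em) h)) })
      (λ a → inj₂ (from (¬⊎¬⇔× em) (¬eq , from rest a)))
      where
      rest = Sat-cases M θ ν k (marked ∘ suc) λ h → other λ { zero → ¬eq ; (suc i) → h i }

  module Relocate {K : ℕ} (loc : Fin K → Location) where

    -- In O the token mark i is at loc i with colors colors i.
    record Env (t c t′ c′ : ℕ) : Set where
      field
        token  : Fin t → Fin t′
        colv   : Fin c → Term t′ c′
        mark   : Fin K → Fin t′
        colors : Fin K → Vec (Term t′ c′) N

    open Env

    liftEᵗ : Env t c t′ c′ → Env (suc t) c (suc t′) c′
    liftEᵗ e = record
      { token  = zero F.∷ (suc ∘ token e)
      ; colv   = substT wkᵗ ∘ colv e
      ; mark   = suc ∘ mark e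
      ; colors = substTs wkᵗ ∘ colors e
      }

    liftEᶜ : Env t c t′ c′ → Env t (suc c) t′ (suc c′)
    liftEᶜ e = record
      { token  = token e
      ; colv   = var zero F.∷ (substT wkᶜ ∘ colv e)
      ; mark   = mark e
      ; colors = substTs wkᶜ ∘ colors e
      }

    -- The translation is in continuation-passing style because a case distinction on
    -- tokens cannot be expressed by a term, only around the atom containing it.
    module _ (e : Env t c t′ c′) where
      mutual
        relocateT : Term t c → (Term t′ c′ → Formula t′ c′) → Formula t′ c′
        relocateT (var z)   κ = κ (colv e z)
        relocateT (δ k x)   κ =
          cases K (mark e) (token e x) (λ i → κ (lookup (colors e i) k)) (κ (δ k (token e x)))
        relocateT (op o ts) κ = relocateTs ts (κ ∘ op o)

        relocateTs : ∀ {n} → Vec (Term t c) n → (Vec (Term t′ c′) n → Formula t′ c′) → Formula t′ c′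
        relocateTs []       κ = κ []
        relocateTs (u ∷ us) κ = relocateT u λ u′ → relocateTs us λ us′ → κ (u′ ∷ us′)

    -- The place of a marked token in the other marking is a constant known in advance, so a place
    -- atom about it is settled while the formula is being built. The decision is computable, as
    -- effectiveness requires.
    constant : {A : Set} → Dec A → Formula t c
    constant (yes _) = true
    constant (no _)  = neg true

    relocate : Env t c t′ c′ → Formula t c → Formula t′ c′
    relocate e true       = true
    relocate e (x == y)   = token e x == token e y
    relocate e (at p x)   =
      cases K (mark e) (token e x) (λ i → constant (loc i ≟ᴸ p)) (at p (token e x))
    relocate e (rel r ts) = relocateTs e ts (rel r)
    relocate e (neg φ)    = neg (relocate e φ)
    relocate e (φ ∨ ψ)    = relocate e φ ∨ relocate e ψ
    relocate e (∃c φ)     = ∃c (relocate (liftEᶜ e) φ)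
    relocate e (∃t φ)     = ∃t (relocate (liftEᵗ e) φ)

    module _ (e : Env t c t′ c′) where
      mutual
        relocateT-QF : ∀ u {κ} → (∀ u′ → QuantifierFree (κ u′)) → QuantifierFree (relocateT e u κ)
        relocateT-QF (var z)   κ-QF = κ-QF _
        relocateT-QF (δ k x)   κ-QF = cases-QF K (λ _ → κ-QF _) (κ-QF _)
        relocateT-QF (op o ts) κ-QF = relocateTs-QF ts (κ-QF ∘ op o)

        relocateTs-QF : ∀ {n} (us : Vec (Term t c) n) {κ} →
                        (∀ us′ → QuantifierFree (κ us′)) → QuantifierFree (relocateTs e us κ)
        relocateTs-QF []       κ-QF = κ-QF []
        relocateTs-QF (u ∷ us) κ-QF =
          relocateT-QF u λ u′ → relocateTs-QF us λ us′ → κ-QF (u′ ∷ us′)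

    constant-QF : {A : Set} (d : Dec A) → QuantifierFree (constant {t} {c} d)
    constant-QF (yes _) = true
    constant-QF (no _)  = neg true

    relocate-QF : (e : Env t c t′ c′) {φ : Formula t c} →
                  QuantifierFree φ → QuantifierFree (relocate e φ)
    relocate-QF e true       = true
    relocate-QF e (x == y)   = _ == _
    relocate-QF e (at p x)   = cases-QF K (λ i → constant-QF (loc i ≟ᴸ p)) (at _ _)
    relocate-QF e (rel r ts) = relocateTs-QF e ts (rel r)
    relocate-QF e (neg q)    = neg (relocate-QF e q)
    relocate-QF e (q ∨ q′)   = relocate-QF e q ∨ relocate-QF e q′

    open PreservesPrenex Env liftEᵗ liftEᶜ relocate
      (λ _ _ → refl) (λ _ _ → refl) (λ _ _ → refl) relocate-QF
      using () renaming (preserves-Σ to relocate-Σ) public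

    module _ (B O : Marking) where

      -- The formula is evaluated in `B` and speaks about `O`. The field `unmarked` covers all
      -- tokens, not just the values of the variables in scope, and so survives the passage under a
      -- token quantifier.
      record Represents (e : Env t c t′ c′) (θ′ : Fin t′ → ℕ) (ν′ : Fin c′ → ℂ)
                        (θ : Fin t → ℕ) (ν : Fin c → ℂ) : Set where
        field
          token-eq  : ∀ x → θ′ (token e x) ≡ θ x
          colv-eq   : ∀ z → eval B θ′ ν′ (colv e z) ≡ ν z
          marked    : ∀ i → O (θ′ (mark e i)) ≡ (loc i , evals B θ′ ν′ (colors e i))
          unmarked  : ∀ u → (∀ i → u ≢ θ′ (mark e i)) → B u ≡ O u

      open Represents

      liftᵗ-represents : ∀ {e : Env t c t′ c′} {θ′ ν′ θ ν} s → Represents e θ′ ν′ θ ν →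
                         Represents (liftEᵗ e) (s F.∷ θ′) ν′ (s F.∷ θ) ν
      liftᵗ-represents {e = e} s R = record
        { token-eq = λ { zero → refl ; (suc x) → token-eq R x }
        ; colv-eq  = λ z →
            trans (eval-substT B wkᵗ (λ _ → refl) (λ _ _ → refl) (colv e z)) (colv-eq R z)
        ; marked   = λ i → trans (marked R i)
            (cong (loc i ,_) (sym (evals-substTs B wkᵗ (λ _ → refl) (λ _ _ → refl) (colors e i))))
        ; unmarked = unmarked R
        }

      liftᶜ-represents : ∀ {e : Env t c t′ c′} {θ′ ν′ θ ν} d → Represents e θ′ ν′ θ ν →
                         Represents (liftEᶜ e) θ′ (d F.∷ ν′) θ (d F.∷ ν)
      liftᶜ-represents {e = e} d R = record
        { token-eq = token-eq R
        ; colv-eq  = λ { zero → refl ; (suc z) →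
            trans (eval-substT B wkᶜ (λ _ → refl) (λ _ _ → refl) (colv e z)) (colv-eq R z) }
        ; marked   = λ i → trans (marked R i)
            (cong (loc i ,_) (sym (evals-substTs B wkᶜ (λ _ → refl) (λ _ _ → refl) (colors e i))))
        ; unmarked = unmarked R
        }

      module _ (em : ExcludedMiddle 0ℓ) where

        module _ {e : Env t c t′ c′} {θ′ ν′ θ ν} (R : Represents e θ′ ν′ θ ν) where

          O-at : ∀ x {i} → θ′ (token e x) ≡ θ′ (mark e i) →
                 O (θ x) ≡ (loc i , evals B θ′ ν′ (colors e i))
          O-at x {i} eq = trans (cong O (trans (sym (token-eq R x)) eq)) (marked R i)

          O-off : ∀ x → (∀ i → θ′ (token e x) ≢ θ′ (mark e i)) → B (θ′ (token e x)) ≡ O (θ x)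
          O-off x off = trans (unmarked R _ off) (cong O (token-eq R x))

          mutual
            -- Which term the continuation receives depends on the branch taken, but its value in
            -- `B` always equals that of `u` in `O`. Hence it suffices to control `κ` on such terms,
            -- and `A` can be the original atom.
            Sat-relocateT : ∀ u {κ} {A : Set} →
              (∀ u′ → eval B θ′ ν′ u′ ≡ eval O θ ν u → Sat B θ′ ν′ (κ u′) ⇔ A) →
              Sat B θ′ ν′ (relocateT e u κ) ⇔ A
            Sat-relocateT (var z)   h = h _ (colv-eq R z)
            Sat-relocateT (δ k x)   h = Sat-cases em B θ′ ν′ K
              (λ i eq → h _ (trans (sym (lookup-evals B θ′ ν′ (colors e i) k))
                                   (cong (λ v → lookup (proj₂ v) k) (sym (O-at x eq)))))
              (λ off → h _ (cong (λ v → lookup (proj₂ v) k) (O-off x off)))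
            Sat-relocateT (op o ts) h = Sat-relocateTs ts λ ts′ eq → h _ (cong (opΩ o) eq)

            Sat-relocateTs : ∀ {n} (us : Vec (Term t c) n) {κ} {A : Set} →
              (∀ us′ → evals B θ′ ν′ us′ ≡ evals O θ ν us → Sat B θ′ ν′ (κ us′) ⇔ A) →
              Sat B θ′ ν′ (relocateTs e us κ) ⇔ A
            Sat-relocateTs []       h = h [] refl
            Sat-relocateTs (u ∷ us) h =
              Sat-relocateT u λ u′ eq → Sat-relocateTs us λ us′ eqs → h _ (cong₂ _∷_ eq eqs)

        Sat-constant : ∀ {θ : Fin t → ℕ} {ν : Fin c → ℂ} {A : Set} (d : Dec A) →
                       Sat B θ ν (constant d) ⇔ A
        Sat-constant (yes a) = mk⇔ (λ _ → a) _
        Sat-constant (no ¬a) = mk⇔ (λ h → contradiction _ h) (λ a _ → ¬a a)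

        Sat-relocate : ∀ {e : Env t c t′ c′} {θ′ ν′ θ ν} → Represents e θ′ ν′ θ ν →
                       ∀ φ → Sat B θ′ ν′ (relocate e φ) ⇔ Sat O θ ν φ
        Sat-relocate R true       = ⇔-id _
        Sat-relocate R (x == y)   = ≡⇒⇔ (cong₂ _≡_ (token-eq R x) (token-eq R y))
        Sat-relocate R (at p x)   = Sat-cases em B _ _ K
          (λ i eq → ≡⇒⇔ (cong (λ v → proj₁ v ≡ p) (sym (O-at R x eq)))
                     ⇔-∘ Sat-constant (loc i ≟ᴸ p))
          (λ off → ≡⇒⇔ (cong (λ v → proj₁ v ≡ p) (O-off R x off)))
        Sat-relocate R (rel r ts) = Sat-relocateTs R ts λ _ eq → ≡⇒⇔ (cong (relΞ r) eq)
        Sat-relocate R (neg φ)    = ¬-cong-⇔ (Sat-relocate R φ)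
        Sat-relocate R (φ ∨ ψ)    = Sat-relocate R φ ⊎-⇔ Sat-relocate R ψ
        Sat-relocate R (∃c φ)     = ∃-cong λ d → Sat-relocate (liftᶜ-represents d R) φ
        Sat-relocate R (∃t φ)     = ∃-cong λ s → Sat-relocate (liftᵗ-represents s R) φ

  -- Changing the places and colors of finitely many tokens

  -- The colors of the tokens `s` are left free in both markings, since firing prescribes only
  -- places there, apart from the guard. So `O` is not determined by `B` and `s`, and its colors
  -- have to be quantified.
  record Change {K : ℕ} (loc loc′ : Fin K → Location) (s : Fin K → ℕ) (B O : Marking) : Set where
    field
      distinct  : Injective _≡_ _≡_ s
      before    : ∀ i → place B (s i) ≡ loc i
      after     : ∀ i → place O (s i) ≡ loc′ i
      unchanged : ∀ u → (∀ i → u ≢ s i) → B u ≡ O u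

  open Change

  Change-sym : ∀ {K} {loc loc′ : Fin K → Location} {s B O} →
               Change loc loc′ s B O → Change loc′ loc s O B
  Change-sym C = record
    { distinct  = distinct C
    ; before    = after C
    ; after     = before C
    ; unchanged = λ u h → sym (unchanged C u h)
    }

  ⋀ : ∀ k → (Fin k → Formula t c) → Formula t c
  ⋀ zero    φ = true
  ⋀ (suc k) φ = φ zero ∧ ⋀ k (φ ∘ suc)

  ⋀-QF : ∀ k {φ : Fin k → Formula t c} → (∀ i → QuantifierFree (φ i)) → QuantifierFree (⋀ k φ)
  ⋀-QF zero    φ-QF = true
  ⋀-QF (suc k) φ-QF = QF-∧ (φ-QF zero) (⋀-QF k (φ-QF ∘ suc))

  closeᵗ : ∀ k → Formula k c → Formula 0 c
  closeᵗ zero    φ = φ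
  closeᵗ (suc k) φ = closeᵗ k (∃t φ)

  closeᶜ : ∀ k → Formula t k → Formula t 0
  closeᶜ zero    φ = φ
  closeᶜ (suc k) φ = closeᶜ k (∃c φ)

  InΣ-closeᵗ : ∀ {n} k {φ : Formula k c} → InΣ (suc n) φ → InΣ (suc n) (closeᵗ k φ)
  InΣ-closeᵗ zero    i = i
  InΣ-closeᵗ (suc k) i = InΣ-closeᵗ k (InΣ-∃t i)

  InΣ-closeᶜ : ∀ {n} k {φ : Formula t k} → InΣ (suc n) φ → InΣ (suc n) (closeᶜ k φ)
  InΣ-closeᶜ zero    i = i
  InΣ-closeᶜ (suc k) i = InΣ-closeᶜ k (InΣ-∃c i)

  Sat-closeᵗ : ∀ M {ν : Fin c → ℂ} k φ → Sat M F.[] ν (closeᵗ k φ) ⇔ (∃[ θ ] Sat M θ ν φ)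
  Sat-closeᵗ M zero    φ = mk⇔
    (λ h → F.[] , h)
    (λ (θ , h) → to (Sat-cong M (λ ()) (λ _ → refl) φ) h)
  Sat-closeᵗ M (suc k) φ = mk⇔
    (λ (θ , s , h) → s F.∷ θ , h)
    (λ (θ , h) → F.tail θ , F.head θ , to (Sat-cong M (head∷tail θ) (λ _ → refl) φ) h)
    ⇔-∘ Sat-closeᵗ M k (∃t φ)

  Sat-closeᶜ : ∀ M {θ : Fin t → ℕ} k φ → Sat M θ F.[] (closeᶜ k φ) ⇔ (∃[ ν ] Sat M θ ν φ)
  Sat-closeᶜ M zero    φ = mk⇔
    (λ h → F.[] , h)
    (λ (ν , h) → to (Sat-cong M (λ _ → refl) (λ ()) φ) h)
  Sat-closeᶜ M (suc k) φ = mk⇔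
    (λ (ν , d , h) → d F.∷ ν , h)
    (λ (ν , h) → F.tail ν , F.head ν , to (Sat-cong M (λ _ → refl) (head∷tail ν) φ) h)
    ⇔-∘ Sat-closeᶜ M k (∃c φ)

  -- The diagonal is made `true` so that `differ` can run over all pairs and still say no more than
  -- injectivity.
  apart : ∀ {k} → Fin k → Fin k → Formula k c
  apart i j with i Fin.≟ j
  ... | yes _ = true
  ... | no _  = neg (i == j)

  apart-QF : ∀ {k} (i j : Fin k) → QuantifierFree (apart {c} i j)
  apart-QF i j with i Fin.≟ j
  ... | yes _ = true
  ... | no _  = neg (i == j)

  Sat-apart : ∀ M {k} (θ : Fin k → ℕ) {ν : Fin c → ℂ} i j →
              Sat M θ ν (apart i j) ⇔ (θ i ≡ θ j → i ≡ j)
  Sat-apart M θ i j with i Fin.≟ j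
  ... | yes i≡j = mk⇔ (λ _ _ → i≡j) _
  ... | no  i≢j = mk⇔ (λ h eq → contradiction eq h) (λ h → i≢j ∘ h)

  differ : ∀ k → Formula k c
  differ k = ⋀ k λ i → ⋀ k λ j → apart i j

  occupy : ∀ {k} → (Fin k → Location) → Formula k c
  occupy {k = k} loc = ⋀ k λ i → at (loc i) i

  -- The colors of the K tokens in O are stored in the color variables combine i k.
  changeFormula : ∀ {K} → (Fin K → Location) → Formula K (K * N) → Closed
  changeFormula {K} loc χ = closeᵗ K (closeᶜ (K * N) (differ K ∧ occupy loc ∧ χ))

  -- The successor level is essential: formulas of level 0 admit no token quantifier, whereas from
  -- level 1 on the leading block is existential and ranges over both sorts. The conjuncts other
  -- than `χ` are quantifier-free and fit any level.
  InΣ-changeFormula : ∀ {n K} {loc : Fin K → Location} {χ} →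
                      InΣ (suc n) χ → InΣ (suc n) (changeFormula loc χ)
  InΣ-changeFormula {n} {K} i = InΣ-closeᵗ K (InΣ-closeᶜ (K * N)
    (InΣ-∧ (quantifier-free (⋀-QF K λ i → ⋀-QF K λ j → apart-QF i j))
      (InΣ-∧ (quantifier-free (⋀-QF K λ i → at _ i)) i)))
    where
    quantifier-free : {φ : Formula t c} → QuantifierFree φ → InΣ (suc n) φ
    quantifier-free q = _ , ε , QF⇒Σ (suc n) q

  Stores : ∀ {K} → (Fin (K * N) → ℂ) → (Fin K → ℕ) → Marking → Set
  Stores ν s O = ∀ i k → ν (combine i k) ≡ color O k (s i)

  module _ {K : ℕ} (loc′ : Fin K → Location) (B : Marking)
           (s : Fin K → ℕ) (ν : Fin (K * N) → ℂ) where

    -- The marking encoded by a choice of tokens and colors: the witness for `O` when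
    -- `changeFormula` holds in `B`.
    modify : Marking
    modify u with Fin.any? (λ i → u ≟ s i)
    ... | yes (i , _) = loc′ i , tabulate (λ k → ν (combine i k))
    ... | no _        = B u

    modify-at : Injective _≡_ _≡_ s → ∀ i → modify (s i) ≡ (loc′ i , tabulate (λ k → ν (combine i k)))
    modify-at inj i with Fin.any? (λ j → s i ≟ s j)
    -- The search may stop at another index naming the same token; injectivity identifies it with
    -- `i`.
    ... | yes (j , eq) = cong (λ j → loc′ j , tabulate (λ k → ν (combine j k))) (sym (inj eq))
    ... | no ¬any      = contradiction (i , refl) ¬any

    modify-off : ∀ u → (∀ i → u ≢ s i) → B u ≡ modify u
    modify-off u off with Fin.any? (λ i → u ≟ s i)
    ... | yes (i , eq) = contradiction eq (off i)
    ... | no _         = refl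

  module _ (em : ExcludedMiddle 0ℓ) where

    Sat-⋀ : ∀ M {θ : Fin t → ℕ} {ν : Fin c → ℂ} k (φ : Fin k → Formula t c) →
            Sat M θ ν (⋀ k φ) ⇔ (∀ i → Sat M θ ν (φ i))
    Sat-⋀ M zero    φ = mk⇔ (λ _ ()) _
    Sat-⋀ M (suc k) φ = mk⇔
      (λ { (h , hs) zero → h ; (h , hs) (suc i) → to (Sat-⋀ M k (φ ∘ suc)) hs i })
      (λ h → h zero , from (Sat-⋀ M k (φ ∘ suc)) (h ∘ suc))
      ⇔-∘ ¬⊎¬⇔× em

    Sat-differ : ∀ M {k} (θ : Fin k → ℕ) {ν : Fin c → ℂ} →
                 Sat M θ ν (differ k) ⇔ Injective _≡_ _≡_ θ
    Sat-differ M {k} θ = mk⇔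
      (λ h {i} {j} → to (Sat-apart M θ i j) (to (Sat-⋀ M k _) (to (Sat-⋀ M k _) h i) j))
      (λ inj → from (Sat-⋀ M k _) λ i → from (Sat-⋀ M k _) λ j → from (Sat-apart M θ i j) inj)

    -- First-order quantifiers over finitely many tokens and colors stand in for a quantifier over
    -- markings. A valuation yields `O` by `modify`; conversely the colors are read off a given `O`.
    -- In both cases `Stores` links the two, and `χ⇔A` applies.
    Sat-changeFormula :
      ∀ {K} {loc loc′ : Fin K → Location} {χ} {A : Marking → Marking → (Fin K → ℕ) → Set} →
      (∀ {B O s ν} → Change loc loc′ s B O → Stores ν s O → Sat B s ν χ ⇔ A B O s) →
      ∀ B → Sat B F.[] F.[] (changeFormula loc χ) ⇔ (∃[ s ] ∃[ O ] (Change loc loc′ s B O × A B O s))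
    Sat-changeFormula {K} {loc} {loc′} {χ} {A} χ⇔A B =
      (∃-cong λ s → mk⇔ (λ (ν , h) → realise s ν h) (assign s)) ⇔-∘
      ((∃-cong λ s → (∃-cong λ ν → conjuncts s ν) ⇔-∘ Sat-closeᶜ B (K * N) _) ⇔-∘ Sat-closeᵗ B K _)
      where
      conjuncts : ∀ s ν → Sat B s ν (differ K ∧ occupy loc ∧ χ) ⇔
                  (Injective _≡_ _≡_ s × (∀ i → place B (s i) ≡ loc i) × Sat B s ν χ)
      conjuncts s ν =
        (Sat-differ B s ×-⇔ ((Sat-⋀ B K _ ×-⇔ ⇔-id _) ⇔-∘ ¬⊎¬⇔× em)) ⇔-∘ ¬⊎¬⇔× em

      realise : ∀ s ν → Injective _≡_ _≡_ s × (∀ i → place B (s i) ≡ loc i) × Sat B s ν χ →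
                ∃[ O ] (Change loc loc′ s B O × A B O s)
      realise s ν (inj , located , h) = modify loc′ B s ν , C , to (χ⇔A C stores) h
        where
        C : Change loc loc′ s B (modify loc′ B s ν)
        C = record
          { distinct  = inj
          ; before    = located
          ; after     = λ i → cong proj₁ (modify-at loc′ B s ν inj i)
          ; unchanged = modify-off loc′ B s ν
          }

        stores : Stores ν s (modify loc′ B s ν)
        stores i k = sym (trans (cong (λ v → lookup (proj₂ v) k) (modify-at loc′ B s ν inj i))
                                (lookup∘tabulate (λ k → ν (combine i k)) k))

      assign : ∀ s → ∃[ O ] (Change loc loc′ s B O × A B O s) →
               ∃[ ν ] (Injective _≡_ _≡_ s × (∀ i → place B (s i) ≡ loc i) × Sat B s ν χ)
      assign s (O , C , a) = ν , distinct C , before C , from (χ⇔A C stores) a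
        where
        ν : Fin (K * N) → ℂ
        ν z = let (i , k) = remQuot {K} N z in color O k (s i)

        stores : Stores ν s O
        stores i k = cong (λ (i , k) → color O k (s i)) (Fin.remQuot-combine i k)

  -- Firing a transition

  module _ (τ : Transition) where
    open Transition τ

    locIn locOut : Fin (n + m) → Location
    locIn  = (just ∘ input) F.++ λ _ → nothing
    locOut = (λ _ → nothing) F.++ (just ∘ output)

    newColors : (Fin (n + m) → ℕ) → Marking → Fin (m * N) → ℂ
    newColors s M z = let (j , k) = remQuot {m} N z in color M k (s (n ↑ʳ j))

    freshGuard : Formula (n + m) 0 → Formula (n + m) (m * N)
    freshGuard = substF (freshColors n m)

    -- Joining consumed and produced tokens into one family turns a firing into a single `Change`,
    -- whose two ends can be exchanged by `Change-sym`.
    Firing : Marking → Marking → (Fin (n + m) → ℕ) → Set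
    Firing M M′ s = Change locIn locOut s M M′ × Sat M s (newColors s M′) (freshGuard guard)

    Fires⇒Firing : ∀ {M M′} → Fires τ M M′ → ∃ (Firing M M′)
    Fires⇒Firing {M} {M′} f = s F.++ s′ , change ,
      to (Sat-cong M (λ _ → refl)
           (λ z → let (j , k) = remQuot {m} N z in cong (color M′ k) (sym (onʳ j)))
           (freshGuard guard))
         guarded
      where
      open Fires f hiding (unchanged)

      onˡ : ∀ i → (s F.++ s′) (i ↑ˡ m) ≡ s i
      onˡ = lookup-++ˡ s s′

      onʳ : ∀ j → (s F.++ s′) (n ↑ʳ j) ≡ s′ j
      onʳ = lookup-++ʳ s s′

      placed : ∀ {M : Marking} {l : Fin n → Location} {r : Fin m → Location} →
               (∀ i → place M (s i) ≡ l i) → (∀ j → place M (s′ j) ≡ r j) →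
               ∀ x → place M ((s F.++ s′) x) ≡ (l F.++ r) x
      placed {M} {l} {r} hˡ hʳ = ↑-elim _
        (λ i → trans (cong (place M) (onˡ i)) (trans (hˡ i) (sym (lookup-++ˡ l r i))))
        (λ j → trans (cong (place M) (onʳ j)) (trans (hʳ j) (sym (lookup-++ʳ l r j))))

      -- A consumed token lies on a proper place of `M` and a produced one on `nothing`; so the two
      -- families are disjoint, which the definition of firing only implies.
      s≢s′ : ∀ i j → s i ≢ s′ j
      s≢s′ i j eq with () ← trans (sym (proj₁ (consumed i)))
                                  (trans (cong (place M) eq) (proj₁ (produced j)))

      injective : ∀ x y → (s F.++ s′) x ≡ (s F.++ s′) y → x ≡ y
      injective = ↑-elim _
        (λ i → ↑-elim _
          (λ i′ eq → cong (_↑ˡ m) (s-distinct (trans (sym (onˡ i)) (trans eq (onˡ i′)))))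
          (λ j eq → contradiction (trans (sym (onˡ i)) (trans eq (onʳ j))) (s≢s′ i j)))
        (λ j → ↑-elim _
          (λ i eq → contradiction (trans (sym (onˡ i)) (trans (sym eq) (onʳ j))) (s≢s′ i j))
          (λ j′ eq → cong (n ↑ʳ_) (s′-distinct (trans (sym (onʳ j)) (trans eq (onʳ j′))))))

      change : Change locIn locOut (s F.++ s′) M M′
      change = record
        { distinct  = λ {x} {y} → injective x y
        ; before    = placed {M} (proj₁ ∘ consumed) (proj₁ ∘ produced)
        ; after     = placed {M′} (proj₂ ∘ consumed) (proj₂ ∘ produced)
        ; unchanged = λ u h → Fires.unchanged f u
            (λ i eq → h (i ↑ˡ m) (trans eq (sym (onˡ i))))
            (λ j eq → h (n ↑ʳ j) (trans eq (sym (onʳ j))))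
        }

    Firing⇒Fires : ∀ {M M′} → ∃ (Firing M M′) → Fires τ M M′
    Firing⇒Fires {M} {M′} (s , C , g) = record
      { s           = sˡ
      ; s′          = sʳ
      ; s-distinct  = λ eq → Fin.↑ˡ-injective m _ _ (distinct C eq)
      ; s′-distinct = λ eq → Fin.↑ʳ-injective n _ _ (distinct C eq)
      ; consumed    = λ i → trans (before C (i ↑ˡ m)) (lookup-++ˡ (just ∘ input) (λ _ → nothing) i)
                          , trans (after C (i ↑ˡ m)) (lookup-++ˡ (λ _ → nothing) (just ∘ output) i)
      ; produced    = λ j → trans (before C (n ↑ʳ j)) (lookup-++ʳ (just ∘ input) (λ _ → nothing) j)
                          , trans (after C (n ↑ʳ j)) (lookup-++ʳ {m = n} (λ _ → nothing) (just ∘ output) j)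
      ; unchanged   = λ u h h′ → unchanged C u (↑-elim _ h h′)
      ; guarded     = to (Sat-cong M
          (↑-elim _ (λ i → sym (lookup-++ˡ sˡ sʳ i)) (λ j → sym (lookup-++ʳ sˡ sʳ j)))
          (λ _ → refl) (freshGuard guard)) g
      }
      where
      sˡ : Fin n → ℕ
      sˡ i = s (i ↑ˡ m)

      sʳ : Fin m → ℕ
      sʳ j = s (n ↑ʳ j)

    Fires⇔Firing : ∀ {M M′} → Fires τ M M′ ⇔ ∃ (Firing M M′)
    Fires⇔Firing = mk⇔ Fires⇒Firing Firing⇒Fires

  -- Images of a definable set under one transition

  module _ (em : ExcludedMiddle 0ℓ) (d : ℂ) (M : Marking) {φ φ′ : Formula t c}
           (r : φ ⇝* φ′) where

    Sat-⇝* : ∀ (θ : Fin t → ℕ) ν → Sat M θ ν φ ⇔ Sat M θ ν φ′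
    Sat-⇝* θ ν = attach φ′ ⇔-∘ (⇝*-sound em d M r (tokenIn M ∘ θ) ν ⇔-∘ ⇔-sym (attach φ))
      where
      attach : ∀ ψ → Sat⋆ M (tokenIn M ∘ θ) ν ψ ⇔ Sat M θ ν ψ
      attach = Sat⋆⇔Sat M (λ _ → refl) (λ _ → refl)

    -- Instead of commuting conversion steps with substitution, `σ` is moved into the valuation,
    -- where `⇝*` is sound. The resulting valuation may give tokens colors foreign to `M`, which
    -- `Sat⋆` allows.
    Sat-substF-⇝* : (σ : Subst t c t′ c′) → ∀ θ ν → Sat M θ ν (substF σ φ) ⇔ Sat M θ ν (substF σ φ′)
    Sat-substF-⇝* σ θ ν = ⇔-sym (detach φ′) ⇔-∘ (⇝*-sound em d M r _ _ ⇔-∘ detach φ)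
      where
      θ⋆ = tokenIn M ∘ θ

      detach : ∀ ψ → Sat M θ ν (substF σ ψ) ⇔
        Sat⋆ M (λ x → θ (Subst.token σ x) , tabulate (λ k → eval⋆ θ⋆ ν (Subst.delta σ k x)))
               (λ z → eval⋆ θ⋆ ν (Subst.colv σ z)) ψ
      detach ψ = Sat⋆-substF M σ (λ _ → refl) (λ _ → refl) (λ k x → sym (lookup∘tabulate _ k)) ψ
        ⇔-∘ ⇔-sym (Sat⋆⇔Sat M (λ _ → refl) (λ _ → refl) (substF σ ψ))

  module Images (k₀ : Fin N) {l : ℕ} {φ : Closed} (φ∈Σ : InΣ (suc l) φ)
                (τ : Transition) (guard∈Σ : InΣ (suc l) (Transition.guard τ)) where

    open Transition τ using (n; m; guard)

    private
      K = n + m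
      φ₁     = proj₁ φ∈Σ
      guard₁ = freshGuard τ (proj₁ guard∈Σ)

      φ₁-prenex     = proj₂ (proj₂ φ∈Σ)
      guard₁-prenex = substF-Σ (freshColors n m) (proj₂ (proj₂ guard∈Σ))

    module _ {loc′ : Fin K → Location} where
      open Relocate loc′

      stored : (Fin t → Fin K) → (Fin c → Term K (K * N)) → Env t c K (K * N)
      stored token colv = record
        { token  = token
        ; colv   = colv
        ; mark   = id
        ; colors = λ i → tabulate λ k → var (combine i k)
        }

      stored-represents : ∀ {loc B O s ν} {token : Fin t → Fin K} {colv : Fin c → Term K (K * N)} →
                          Change loc loc′ s B O → Stores ν s O →
                          Represents B O (stored token colv) s ν (s ∘ token) (eval B s ν ∘ colv)
      stored-represents {B = B} {O} {s} {ν} C stores = record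
        { token-eq = λ _ → refl
        ; colv-eq  = λ _ → refl
        ; marked   = λ i → cong₂ _,_ (after C i)
            (sym (trans (evals-tabulate B s ν _)
                 (trans (tabulate-cong (stores i)) (tabulate∘lookup _))))
        ; unmarked = unchanged C
        }

    -- Shared by both images. The formula `φ` always speaks of the other marking `O`; the guard
    -- speaks of `O` for successors and of `B` for predecessors, so its translation is left as the
    -- parameter `χ`.
    definable-by-change :
      (loc loc′ : Fin K → Location) (χ : Formula K (K * N)) → PrenexΣ (suc l) χ →
      (A : Marking → Marking → (Fin K → ℕ) → Set) →
      (ExcludedMiddle 0ℓ → ∀ {B O s ν} → Change loc loc′ s B O → Stores ν s O →
        Sat B s ν χ ⇔ A B O s) →
      EffectivelyDefinable (InΣ (suc l))
        (λ B → ∃[ O ] (O ∈ ⟦ φ ⟧ × ∃[ s ] (Change loc loc′ s B O × A B O s)))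
    definable-by-change loc loc′ χ p A χ⇔A =
      changeFormula loc (relocate (stored (λ ()) (λ ())) φ₁ ∧ χ) ,
      InΣ-changeFormula {loc = loc} (InΣ-∧ (_ , ε , relocate-Σ _ φ₁-prenex) (_ , ε , p)) ,
      λ em →
        (λ { {B} (O , o , s , C , a) → from (correct em B) (s , O , C , o , a) }) ,
        (λ { {B} h → let (s , O , C , o , a) = to (correct em B) h in O , o , s , C , a })
      where
      open Relocate loc′ using (relocate; relocate-Σ; Sat-relocate)

      φ-correct : ExcludedMiddle 0ℓ → ∀ {B O s ν} → Change loc loc′ s B O → Stores ν s O →
                  Sat B s ν (relocate (stored (λ ()) (λ ())) φ₁) ⇔ O ∈ ⟦ φ ⟧
      φ-correct em {B} {O} C stores =
        -- The color of token 0 in `O` witnesses that `ℂ` is inhabited, as the soundness of `⇝*`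
        -- demands.
        ⇔-sym (Sat-⇝* em (color O k₀ 0) O (proj₁ (proj₂ φ∈Σ)) F.[] F.[])
        ⇔-∘ (Sat-cong O (λ ()) (λ ()) φ₁ ⇔-∘ Sat-relocate B O em (stored-represents C stores) φ₁)

      correct : ExcludedMiddle 0ℓ → ∀ B → _ ⇔ _
      correct em B = Sat-changeFormula em {loc = loc} {loc′}
        {A = λ B O s → O ∈ ⟦ φ ⟧ × A B O s}
        (λ C stores → (φ-correct em C stores ×-⇔ χ⇔A em C stores) ⇔-∘ ¬⊎¬⇔× em) B

    guard-correct : ExcludedMiddle 0ℓ → ∀ M s ν →
                    Sat M s ν guard₁ ⇔ Sat M s ν (freshGuard τ guard)
    guard-correct em M s ν =
      ⇔-sym (Sat-substF-⇝* em (color M k₀ 0) M (proj₁ (proj₂ guard∈Σ)) (freshColors n m) s ν)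

    post-definable :
      EffectivelyDefinable (InΣ (suc l)) (λ M′ → ∃[ M ] (M ∈ ⟦ φ ⟧ × ∃ (Firing τ M M′)))
    post-definable =
      let (ψ , ψ∈Σ , correct) = definable-by-change (locOut τ) (locIn τ)
            (relocate e guard₁) (relocate-Σ e guard₁-prenex)
            (λ B O s → Sat O s (newColors τ s B) (freshGuard τ guard))
            λ em {B} {O} {s} {ν} C stores → guard-correct em O s _
              ⇔-∘ Sat-relocate B O em (stored-represents C stores) guard₁
      in ψ , ψ∈Σ , λ em →
        (λ { (M , o , s , C , g) → proj₁ (correct em) (M , o , s , Change-sym C , g) }) ,
        (λ h → let (M , o , s , C , g) = proj₂ (correct em) h in M , o , s , Change-sym C , g)
      where
      open Relocate (locIn τ)

      e : Env K (m * N) K (K * N)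
      -- The base marking is the one after the firing, so the new color of a produced token is its
      -- own color there.
      e = stored id λ z → let (j , k) = remQuot {m} N z in δ k (n ↑ʳ j)

    pre-definable :
      EffectivelyDefinable (InΣ (suc l)) (λ M → ∃[ M′ ] (M′ ∈ ⟦ φ ⟧ × ∃ (Firing τ M M′)))
    pre-definable = definable-by-change (locIn τ) (locOut τ)
      (relocate e guard₁) (relocate-Σ e guard₁-prenex)
      (λ B O s → Sat B s (newColors τ s O) (freshGuard τ guard))
      λ em {B} {O} {s} {ν} C stores → guard-correct em B s _ ⇔-∘ Sat-relocate B B em (record
        { token-eq = λ _ → refl
        ; colv-eq  = λ z → let (j , k) = remQuot {m} N z in stores (n ↑ʳ j) k
        ; marked   = λ ()
        ; unmarked = λ _ _ → refl
        }) guard₁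
      where
      -- The guard already speaks of the base marking, so no token is marked, and relocation reduces
      -- to replacing each fresh color variable by the stored color of the produced token after the
      -- firing.
      open Relocate {0} (λ ())

      e : Env K (m * N) K (K * N)
      e = record
        { token  = id
        ; colv   = λ z → let (j , k) = remQuot {m} N z in var (combine (n ↑ʳ j) k)
        ; mark   = λ ()
        ; colors = λ ()
        }

  -- Union over the transitions of a net

  EffectivelyDefinable-cong : ∀ {n} {𝓜 𝓜′ : Pred Marking 0ℓ} → 𝓜 ≐ 𝓜′ →
                              EffectivelyDefinable (InΣ n) 𝓜 → EffectivelyDefinable (InΣ n) 𝓜′
  EffectivelyDefinable-cong (⊆ , ⊇) (ψ , i , correct) =
    ψ , i , λ em → (λ x → proj₁ (correct em) (⊇ x)) , (λ x → ⊆ (proj₂ (correct em) x))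

  Any-definable : ∀ {n} {R : Transition → Pred Marking 0ℓ} {S} →
    All (λ τ → EffectivelyDefinable (InΣ n) (R τ)) S →
    EffectivelyDefinable (InΣ n) (λ M → Any (λ τ → M ∈ R τ) S)
  Any-definable {n} [] = neg true , (_ , ε , QF⇒Σ n (neg true)) ,
    λ em → (λ ()) , (λ h → contradiction _ h)
  Any-definable ((ψ , i , correct) ∷ defs) =
    let (χ , j , corrects) = Any-definable defs in
    ψ ∨ χ , InΣ-∨ i j , λ em →
      (λ { (here r)   → inj₁ (proj₁ (correct em) r)
         ; (there rs) → inj₂ (proj₁ (corrects em) rs) }) ,
      (λ { (inj₁ h) → here (proj₂ (correct em) h)
         ; (inj₂ h) → there (proj₂ (corrects em) h) })

  module _ (k₀ : Fin N) {l : ℕ} {S : CPN} (S∈ : S ∈ CPN[ InΣ (suc l) ])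
           {φ : Closed} (φ∈Σ : InΣ (suc l) φ) where

    post-effective : EffectivelyDefinable (InΣ (suc l)) (post S ⟦ φ ⟧)
    post-effective = EffectivelyDefinable-cong (Any-∃⁻ , Any-∃⁺)
      (Any-definable (All.map (λ {τ} g∈Σ → EffectivelyDefinable-cong
        ( (λ (M , o , f) → M , o , from (Fires⇔Firing τ) f)
        , (λ (M , o , f) → M , o , to (Fires⇔Firing τ) f))
        (Images.post-definable k₀ φ∈Σ τ g∈Σ)) S∈))

    pre-effective : EffectivelyDefinable (InΣ (suc l)) (pre S ⟦ φ ⟧)
    pre-effective = EffectivelyDefinable-cong (Any-∃⁻ , Any-∃⁺)
      (Any-definable (All.map (λ {τ} g∈Σ → EffectivelyDefinable-cong
        ( (λ (M′ , o , f) → M′ , o , from (Fires⇔Firing τ) f)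
        , (λ (M′ , o , f) → M′ , o , to (Fires⇔Firing τ) f))
        (Images.pre-definable k₀ φ∈Σ τ g∈Σ)) S∈))

theorem7p1 : (P N : ℕ) → 1 ≤ N → (𝒞 : ColorStructure) → let open CML P N 𝒞 in
    (n : ℕ) → n ≡ 1 ⊎ n ≡ 2 →
    (S : CPN) → S ∈ CPN[ InΣ n ] →
    (φ : Closed) → InΣ n φ →
    EffectivelyDefinable (InΣ n) (post S ⟦ φ ⟧) × EffectivelyDefinable (InΣ n) (pre S ⟦ φ ⟧)
theorem7p1 P N 1≤N 𝒞 n n≡1⊎n≡2 S S∈ φ φ∈Σ with n≡1⊎n≡2
-- `1 ≤ N` unfolds to `0 < N`; the index it gives selects the color component that inhabits `ℂ`.
... | inj₁ refl = post-effective (fromℕ< 1≤N) S∈ φ∈Σ , pre-effective (fromℕ< 1≤N) S∈ φ∈Σ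
  where open Development P N 𝒞
... | inj₂ refl = post-effective (fromℕ< 1≤N) S∈ φ∈Σ , pre-effective (fromℕ< 1≤N) S∈ φ∈Σ
  where open Development P N 𝒞
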